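{- Let $A \in \mathbb{Z}^{m \times m}$ and define the sequence $(S_n)_{n \in \mathbb{N}}$, where $S_n$ is the Smith form (over $\mathbb{Z}$) of $A^n$ normalized to have nonnegative diagonal entries. Then there exists an eventually periodic sequence $(D_n)_{n \in \mathbb{N}} \subset \mathbb{Z}^{m \times m}$ of diagonal matrices such that $S_{n+1} = D_n S_n$ for all $n \in \mathbb{N}$.
   Context: $\mathbb{N} = \{0,1,2,\dots\}$. A square matrix over $\mathbb{Z}$ is unimodular if its determinant is $\pm 1$. The Smith form of $M \in \mathbb{Z}^{m\times m}$ is the diagonal matrix $S$ with $S_{ii} \mid S_{i+1,i+1}$ for $1 \le i \le m-1$ such that $M = USV$ for some unimodular $U, V \in \mathbb{Z}^{m\times m}$; it is unique once its diagonal entries are required to be nonnegative (zero diagonal entries are allowed). A sequence $(f(n))_{n\in\mathbb{N}}$ is eventually periodic if there exist $n_0 \in \mathbb{N}$ and an integer $T>0$ such that $f(n+T)=f(n)$ for all $n \ge n_0$. -}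

module Defs where

open import Algebra.Properties.Semiring.Sum using (sum)
open import Data.Bool.Base using (if_then_else_)
open import Data.Fin.Base using (Fin; zero; suc; toℕ; punchIn)
open import Data.Fin.Properties using (_≟_)
open import Data.Integer.Base as ℤ using (ℤ; 0ℤ; 1ℤ; -1ℤ)
open import Data.Integer.Divisibility.Signed using (_∣_)
open import Data.Integer.Properties using (+-*-semiring)
open import Data.Nat.Base as ℕ using (ℕ; zero; suc)
open import Data.Product.Base using (∃-syntax; _×_)
open import Data.Sum.Base using (_⊎_)
open import Level using (Level)
open import Relation.Binary.Core using (Rel)
open import Relation.Binary.PropositionalEquality.Core using (_≡_; _≢_)
open import Relation.Nullary.Decidable.Core using (does)

Matrix : ℕ → Set
Matrix m = Fin m → Fin m → ℤ

infix 4 _≈_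

-- Entrywise, since function extensionality is not available.
_≈_ : ∀ {m} → Matrix m → Matrix m → Set
M ≈ N = ∀ i j → M i j ≡ N i j

infixl 7 _·_

_·_ : ∀ {m} → Matrix m → Matrix m → Matrix m
(M · N) i j = sum +-*-semiring (λ k → M i k ℤ.* N k j)

identity : ∀ {m} → Matrix m
identity i j = if does (i ≟ j) then 1ℤ else 0ℤ

infixr 8 _^_

_^_ : ∀ {m} → Matrix m → ℕ → Matrix m
M ^ zero  = identity
M ^ suc n = M · M ^ n

-- Laplace expansion along the first row; punchIn j skips column j.
det : ∀ {m} → Matrix m → ℤ
det {zero}  M = 1ℤ
det {suc m} M = sum +-*-semiring λ j →
  (-1ℤ ℤ.^ toℕ j) ℤ.* M zero j ℤ.* det (λ i k → M (suc i) (punchIn j k))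

Unimodular : ∀ {m} → Matrix m → Set
Unimodular M = det M ≡ 1ℤ ⊎ det M ≡ -1ℤ

Diagonal : ∀ {m} → Matrix m → Set
Diagonal M = ∀ i j → i ≢ j → M i j ≡ 0ℤ

-- 0 ∣ 0 holds for this divisibility relation, so zero diagonal entries are
-- allowed (necessarily in last positions).
record IsSmithForm {m} (M S : Matrix m) : Set where
  field
    diagonal      : Diagonal S
    nonnegative   : ∀ i → 0ℤ ℤ.≤ S i i
    divisibility  : ∀ i j → toℕ j ≡ suc (toℕ i) → S i i ∣ S j j
    factorization : ∃[ U ] ∃[ V ] Unimodular U × Unimodular V × M ≈ U · S · V

EventuallyPeriodic : ∀ {a ℓ : Level} {A : Set a} → Rel A ℓ → (ℕ → A) → Set ℓ
EventuallyPeriodic _∼_ f =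
  ∃[ n₀ ] ∃[ T ] T ℕ.> 0 × (∀ n → n ℕ.≥ n₀ → f (n ℕ.+ T) ∼ f n)

{-# OPTIONS --safe #-}
module Submission where

-- The product of the first j invariant factors of Aⁿ is the gcd g(n) of its j × j minors, and by multilinearity
-- of the determinant the vector u(n) of these minors is an orbit of an integral linear map. After rescaling,
-- u satisfies a monic integral recurrence of minimal order, so that u(n) is represented by yⁿ in some
-- ℤ[y] / (y^(d+1) - Σ β k y^k), and g(n) is, up to a bounded factor, the gcd of the coefficients of yⁿ. The smallest
-- slopes of the p-adic Newton polygons, for all primes p at once, are encoded by integers c and e for which
-- y^e / c is integral: cᵗ divides y^(et) up to a bounded factor, and conversely the coefficients of y^(et) have
-- gcd dividing cᵗ. Hence y^(et) / cᵗ takes two equal values modulo any given M, which forces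
-- g(n + T) = c^τ g(n) for large n. Dividing these relations for j and j + 1 shows that the ratios of successive
-- values of each invariant factor are eventually periodic.

open import Defs
open import Data.Fin.Base as Fin
  using (Fin; zero; suc; toℕ; fromℕ<; inject₁; inject≤; punchIn; punchOut; combine; finToFun; funToFin; _↑ˡ_; _↑ʳ_)
import Data.Fin.Properties as Fin
open import Data.Integer.Base as ℤ using (ℤ; 0ℤ; 1ℤ; -1ℤ; _+_; _*_; -_; _-_)
  renaming (+_ to pos; _^_ to _^ᶻ_)
open import Data.Integer.Divisibility.Signed
open import Data.Integer.DivMod using (_%ℕ_; _/ℕ_; n%ℕd<d; a≡a%ℕn+[a/ℕn]*n)
import Data.Integer.Properties as ℤ
open import Data.Integer.Tactic.RingSolver using (solve-∀)
open import Data.List.Base using ([]; _∷_)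
open import Data.List.Relation.Unary.All using (_∷_)
open import Data.Nat.Base as ℕ using (ℕ; zero; suc; s≤s; z≤n)
import Data.Nat.Divisibility as ℕ
import Data.Nat.DivMod as ℕ
import Data.Nat.GCD as ℕ
import Data.Nat.Properties as ℕ
open import Data.Nat.Primality using (Prime; euclidsLemma; prime[2]; prime⇒nonTrivial)
open import Data.Nat.Primality.Factorisation using (factorise)
open import Data.Product.Base using (∃-syntax; Σ-syntax; _×_; _,_; proj₁; proj₂; swap)
open import Data.Sum.Base using (_⊎_; inj₁; inj₂; [_,_]′)
open import Data.Vec.Functional using (insertAt; updateAt)
open import Data.Vec.Functional.Properties
  using (insertAt-lookup; insertAt-punchIn; updateAt-updates; updateAt-minimal)
open import Function.Base using (_∘_; const)
open import Relation.Binary.Definitions using (tri<; tri≈; tri>)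
open import Relation.Binary.PropositionalEquality
open import Relation.Nullary using (¬_; Dec; yes; no; contradiction; ¬?; _×-dec_)
open import Relation.Nullary.Decidable using (decidable-stable)

open import Algebra.Properties.Semiring.Sum ℤ.+-*-semiring
import Algebra.Properties.CommutativeMonoid.Sum ℤ.*-1-commutativeMonoid as ∏
open ∏ using () renaming (sum to ∏)

-- Divisibility and contents of integer vectors

-- The obstacle is that the smallest slope varies with the prime and is only rational. Valuations
-- and number fields are replaced by divisibility statements about e-th powers of integers, with e a
-- common multiple of all possible denominators of slopes. One coincidence modulo a fixed M controls
-- every later n for the following reason. After multiplication by h = c^d, the coefficients of y^(e
-- t₂) and of c^T y^(e t₁), with t₂ = t₁ + T, agree modulo c^t₂ M. Multiplying by y^(et+r) with r <
-- e contributes a further factor c^t, at the cost of another h. The two contents to be compared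
-- divide δ c^(t₂+t+1), where δ is the denominator of coordinates in the chosen independent vectors.
-- Hence M = h h δ c makes the congruence fine enough to see both contents, for all t at once. If c
-- = 0, the recurrence kills u. Integrality of the ratios is a separate matter: quotients of
-- determinantal divisors do not show that an invariant factor divides its successor, so this is
-- proved directly with a kernel vector.

∣0 : ∀ {k} → k ∣ 0ℤ
∣0 {k} = divides 0ℤ (sym (ℤ.*-zeroˡ k))

*-cancelˡ-≢0 : ∀ c {x y} → c ≢ 0ℤ → c * x ≡ c * y → x ≡ y
*-cancelˡ-≢0 c {x} {y} c≢0 = ℤ.*-cancelˡ-≡ c x y {{ℤ.≢-nonZero c≢0}}

∣-cancelˡ-≢0 : ∀ c {x y} → c ≢ 0ℤ → c * x ∣ c * y → x ∣ y
∣-cancelˡ-≢0 c c≢0 = *-cancelˡ-∣ c {{ℤ.≢-nonZero c≢0}}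

*-≢0 : ∀ {x y} → x ≢ 0ℤ → y ≢ 0ℤ → x * y ≢ 0ℤ
*-≢0 {x} x≢0 y≢0 eq = [ x≢0 , y≢0 ]′ (ℤ.i*j≡0⇒i≡0∨j≡0 x eq)

^-≢0 : ∀ {x} n → x ≢ 0ℤ → x ^ᶻ n ≢ 0ℤ
^-≢0 n x≢0 eq = x≢0 (ℤ.i^n≡0⇒i≡0 _ n eq)

*-mono-∣ : ∀ {a b c d} → a ∣ b → c ∣ d → a * c ∣ b * d
*-mono-∣ {a} {b} {c} {d} a∣b c∣d =
  ∣-trans (*-monoˡ-∣ c a∣b) (*-monoʳ-∣ b c∣d)

^-mono-∣ : ∀ {a b} n → a ∣ b → a ^ᶻ n ∣ b ^ᶻ n
^-mono-∣ zero    a∣b = ∣-refl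
^-mono-∣ (suc n) a∣b = *-mono-∣ a∣b (^-mono-∣ n a∣b)

^-distribʳ-* : ∀ x y n → (x * y) ^ᶻ n ≡ x ^ᶻ n * y ^ᶻ n
^-distribʳ-* x y zero    = refl
^-distribʳ-* x y (suc n) =
  trans (cong (x * y *_) (^-distribʳ-* x y n)) (interchange x y (x ^ᶻ n) (y ^ᶻ n))
  where
  interchange : ∀ a b c d → a * b * (c * d) ≡ a * c * (b * d)
  interchange = solve-∀

bezout : ∀ x y → ∃[ g ] ∃[ a ] ∃[ b ] g ∣ x × g ∣ y × g ≡ a * x + b * y
bezout x y with ℕ.Bézout.lemma ℤ.∣ x ∣ ℤ.∣ y ∣ | m∣∣m∣ {x} | m∣∣m∣ {y}
... | ℕ.Bézout.result d (ℕ.GCD.is (d∣x , d∣y) _) bez | divides s ∣x∣≡sx | divides t ∣y∣≡ty =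
  pos d , proj₁ (combination bez) , proj₁ (proj₂ (combination bez)) , ∣ᵤ⇒∣ d∣x , ∣ᵤ⇒∣ d∣y
      , proj₂ (proj₂ (combination bez))
  where
  solveFor : ∀ d a b x y s t → d + b * (t * y) ≡ a * (s * x) → d ≡ a * s * x + - (b * t) * y
  solveFor d a b x y s t eq = begin
    d                                       ≡⟨ lem₁ d (b * (t * y)) ⟩
    d + b * (t * y) - b * (t * y)           ≡⟨ cong (_- b * (t * y)) eq ⟩
    a * (s * x) - b * (t * y)               ≡⟨ lem₂ a s x b t y ⟩
    a * s * x + - (b * t) * y               ∎
    where
    open ≡-Reasoning
    lem₁ : ∀ d e → d ≡ d + e - e
    lem₁ = solve-∀
    lem₂ : ∀ a s x b t y → a * (s * x) - b * (t * y) ≡ a * s * x + - (b * t) * y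
    lem₂ = solve-∀
  cast : ∀ d a b m n → d ℕ.+ b ℕ.* n ≡ a ℕ.* m → pos d + pos b * pos n ≡ pos a * pos m
  cast d a b m n eq = begin
    pos d + pos b * pos n      ≡⟨ cong (pos d +_) (ℤ.pos-* b n) ⟨
    pos d + pos (b ℕ.* n)    ≡⟨ ℤ.pos-+ d (b ℕ.* n) ⟨
    pos (d ℕ.+ b ℕ.* n)    ≡⟨ cong pos eq ⟩
    pos (a ℕ.* m)          ≡⟨ ℤ.pos-* a m ⟩
    pos a * pos m            ∎
    where open ≡-Reasoning
  combination : ℕ.Bézout.Identity d ℤ.∣ x ∣ ℤ.∣ y ∣ → ∃[ a ] ∃[ b ] pos d ≡ a * x + b * y
  combination (ℕ.Bézout.+- a b eq) = pos a * s , - (pos b * t) , solveFor (pos d) (pos a) (pos b) x y s t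
    (subst₂ (λ X Y → pos d + pos b * Y ≡ pos a * X) ∣x∣≡sx ∣y∣≡ty (cast d a b _ _ eq))
  combination (ℕ.Bézout.-+ a b eq) = - (pos a * s) , pos b * t , trans
    (solveFor (pos d) (pos b) (pos a) y x t s
      (subst₂ (λ X Y → pos d + pos a * X ≡ pos b * Y) ∣x∣≡sx ∣y∣≡ty (cast d b a _ _ eq)))
    (ℤ.+-comm (pos b * t * y) _)

-- The multiplier z builds in that gcd(z v) is z gcd(v). No Bézout coefficients are stored, so the
-- index set may be infinite or lack decidable equality, as it does for pairs of selection
-- functions.
record IsContent {I : Set} (g : ℤ) (v : I → ℤ) : Set where
  field
    divisor  : ∀ i → g ∣ v i
    greatest : ∀ K z → (∀ i → K ∣ z * v i) → K ∣ z * g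

open IsContent public

-- Content 1 in the form of `greatest`. For K = 0 it says that z v = 0 forces z = 0, so a primitive
-- vector is nonzero.
Primitive : {I : Set} → (I → ℤ) → Set
Primitive v = ∀ K z → (∀ i → K ∣ z * v i) → K ∣ z

∣-combination : ∀ {K x y} z a b → K ∣ z * x → K ∣ z * y → K ∣ z * (a * x + b * y)
∣-combination {K} {x} {y} z a b p q =
  subst (K ∣_) (sym (lem z a b x y)) (∣m∣n⇒∣m+n (∣n⇒∣m*n a p) (∣n⇒∣m*n b q))
  where
  lem : ∀ z a b x y → z * (a * x + b * y) ≡ a * (z * x) + b * (z * y)
  lem = solve-∀

content : ∀ {n} (v : Fin n → ℤ) → ∃[ g ] IsContent g v
content {zero}  v = 0ℤ , record
  { divisor = λ (); greatest = λ K z _ → subst (K ∣_) (sym (ℤ.*-zeroʳ z)) ∣0 }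
content {suc n} v with content (v ∘ suc)
... | h , hc with bezout (v zero) h
...   | g , a , b , g∣v₀ , g∣h , g≡ = g , record
  { divisor  = λ { zero → g∣v₀ ; (suc i) → ∣-trans g∣h (divisor hc i) }
  ; greatest = λ K z all → subst (λ x → K ∣ z * x) (sym g≡)
      (∣-combination z a b (all zero) (greatest hc K z (all ∘ suc)))
  }

0-content : ∀ {I : Set} {v : I → ℤ} → IsContent 0ℤ v → ∀ i → v i ≡ 0ℤ
0-content c i = 0∣⇒≡0 (divisor c i)

content-0 : ∀ {I : Set} {g} {v : I → ℤ} → IsContent g v → (∀ i → v i ≡ 0ℤ) → g ≡ 0ℤ
content-0 {g = g} c v≡0 = trans (sym (ℤ.*-identityˡ g)) (0∣⇒≡0 (greatest c 0ℤ 1ℤ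
  (λ i → subst (0ℤ ∣_) (sym (trans (ℤ.*-identityˡ _) (v≡0 i))) ∣-refl)))

primitivePart : ∀ {n} (v : Fin n → ℤ) i → v i ≢ 0ℤ →
  ∃[ g ] ∃[ w ] g ≢ 0ℤ × (∀ i → v i ≡ g * w i) × Primitive w
primitivePart v i vᵢ≢0 with content v
... | g , gc = g , w , g≢0 , v≡gw , prim
  where
  g≢0 : g ≢ 0ℤ
  g≢0 refl = vᵢ≢0 (0-content gc i)
  w : _ → ℤ
  w j = quotient (divisor gc j)
  v≡gw : ∀ j → v j ≡ g * w j
  v≡gw j = trans (_∣_.equality (divisor gc j)) (ℤ.*-comm (w j) g)
  lem : ∀ g z w → g * (z * w) ≡ z * (g * w)
  lem = solve-∀
  prim : Primitive w
  prim K z all = ∣-cancelˡ-≢0 g g≢0 (subst (g * K ∣_) (ℤ.*-comm z g) (greatest gc (g * K) z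
    λ j → subst (g * K ∣_) (trans (lem g z (w j)) (cong (z *_) (sym (v≡gw j)))) (*-monoʳ-∣ g (all j))))

-- The two-element case of `Primitive`; powers can then be stripped off one factor at a time, the
-- remaining factors going into z.
Coprime : ℤ → ℤ → Set
Coprime x y = ∀ K z → K ∣ z * x → K ∣ z * y → K ∣ z

coprime-sym : ∀ {x y} → Coprime x y → Coprime y x
coprime-sym cop K z p q = cop K z q p

coprime-^ˡ : ∀ {x y} n → Coprime x y → Coprime (x ^ᶻ n) y
coprime-^ˡ zero    cop K z p q = subst (K ∣_) (ℤ.*-identityʳ z) p
coprime-^ˡ {x} {y} (suc n) cop K z p q = coprime-^ˡ n cop K z
  (cop K (z * x ^ᶻ n) (subst (K ∣_) (lem₁ z x (x ^ᶻ n)) p) (subst (K ∣_) (lem₂ z y (x ^ᶻ n)) (∣m⇒∣m*n (x ^ᶻ n) q))) q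
  where
  lem₁ : ∀ z x w → z * (x * w) ≡ z * w * x
  lem₁ = solve-∀
  lem₂ : ∀ z y w → z * y * w ≡ z * w * y
  lem₂ = solve-∀

coprimeParts : ∀ x y → ∃[ g ] ∃[ x′ ] ∃[ y′ ] x ≡ g * x′ × y ≡ g * y′ × Coprime x′ y′
coprimeParts x y with bezout x y
... | g , a , b , divides x′ x≡ , divides y′ y≡ , g≡ with g ℤ.≟ 0ℤ
-- Both numbers are 0, and the cofactors may be any coprime pair.
...   | yes refl = 0ℤ , 1ℤ , 1ℤ , trans x≡ (ℤ.*-zeroʳ x′) , trans y≡ (ℤ.*-zeroʳ y′)
                 , λ K z p _ → subst (K ∣_) (ℤ.*-identityʳ z) p
...   | no g≢0 = g , x′ , y′ , trans x≡ (ℤ.*-comm x′ g) , trans y≡ (ℤ.*-comm y′ g)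
               , λ K z p q → subst (K ∣_) (trans (cong (z *_) (sym unit)) (ℤ.*-identityʳ z))
                               (∣-combination z a b p q)
  where
  lem : ∀ a b x y g → a * (x * g) + b * (y * g) ≡ g * (a * x + b * y)
  lem = solve-∀
  unit : 1ℤ ≡ a * x′ + b * y′
  unit = *-cancelˡ-≢0 g g≢0 (trans (ℤ.*-identityʳ g)
    (trans (trans g≡ (cong₂ (λ X Y → a * X + b * Y) x≡ y≡)) (lem a b x′ y′ g)))

-- The ultrametric inequality for all primes at once. With g the gcd of x and y, the e-th powers of
-- the cofactors are coprime, so C already divides w g^e; no binomial expansion is involved.
∣-*^-+ : ∀ {C} w x y e → C ∣ w * x ^ᶻ e → C ∣ w * y ^ᶻ e → C ∣ w * (x + y) ^ᶻ e
∣-*^-+ {C} w x y e p q with coprimeParts x y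
... | g , x′ , y′ , refl , refl , cop = subst (C ∣_) (sym rewritten) (∣m⇒∣m*n ((x′ + y′) ^ᶻ e) C∣)
  where
  split : ∀ z → w * (g * z) ^ᶻ e ≡ w * g ^ᶻ e * z ^ᶻ e
  split z = trans (cong (w *_) (^-distribʳ-* g z e)) (sym (ℤ.*-assoc w _ _))
  C∣ : C ∣ w * g ^ᶻ e
  C∣ = coprime-^ˡ e (coprime-sym (coprime-^ˡ e (coprime-sym cop))) C (w * g ^ᶻ e)
         (subst (C ∣_) (split x′) p) (subst (C ∣_) (split y′) q)
  rewritten : w * (g * x′ + g * y′) ^ᶻ e ≡ w * g ^ᶻ e * (x′ + y′) ^ᶻ e
  rewritten = trans (cong (λ t → w * t ^ᶻ e) (sym (ℤ.*-distribˡ-+ g x′ y′))) (split (x′ + y′))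

-- After division by the gcd, the cofactor of a divides a power of a number coprime to it, so it is
-- a unit.
^-cancel-∣ : ∀ {a b} e → a ^ᶻ suc e ∣ b ^ᶻ suc e → a ∣ b
^-cancel-∣ {a} {b} e p with coprimeParts a b
... | g , a′ , b′ , refl , refl , cop with g ℤ.≟ 0ℤ
...   | yes refl = subst (0ℤ * a′ ∣_) (sym (ℤ.*-zeroˡ b′)) ∣0
...   | no g≢0 = *-monoʳ-∣ g (∣-trans a′∣1 (divides b′ (sym (ℤ.*-identityʳ b′))))
  where
  powers : a′ ^ᶻ suc e ∣ b′ ^ᶻ suc e
  powers = ∣-cancelˡ-≢0 (g ^ᶻ suc e) (^-≢0 (suc e) g≢0)
    (subst₂ _∣_ (^-distribʳ-* g a′ (suc e)) (^-distribʳ-* g b′ (suc e)) p)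
  a′∣1 : a′ ∣ 1ℤ
  a′∣1 = coprime-^ˡ (suc e) (coprime-sym cop) a′ 1ℤ
    (subst (a′ ∣_) (sym (ℤ.*-identityˡ _)) (∣-trans (∣m⇒∣m*n _ ∣-refl) powers))
    (subst (a′ ∣_) (sym (ℤ.*-identityˡ _)) ∣-refl)

prime∤1 : ∀ {p} → Prime p → ¬ pos p ∣ 1ℤ
prime∤1 {p} pr p∣1 with ℕ.∣1⇒≡1 (∣⇒∣ᵤ p∣1) | prime⇒nonTrivial pr
... | refl | ()

prime-∣* : ∀ {p} → Prime p → ∀ x y → pos p ∣ x * y → pos p ∣ x ⊎ pos p ∣ y
prime-∣* pr x y p∣xy with euclidsLemma ℤ.∣ x ∣ ℤ.∣ y ∣ pr (subst (_ ℕ.∣_) (ℤ.abs-* x y) (∣⇒∣ᵤ p∣xy))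
... | inj₁ p∣x = inj₁ (∣ᵤ⇒∣ p∣x)
... | inj₂ p∣y = inj₂ (∣ᵤ⇒∣ p∣y)

prime-∣^ : ∀ {p} → Prime p → ∀ x n → pos p ∣ x ^ᶻ n → pos p ∣ x
prime-∣^ pr x zero    p∣ = contradiction p∣ (prime∤1 pr)
prime-∣^ pr x (suc n) p∣ = [ (λ q → q) , prime-∣^ pr x n ]′ (prime-∣* pr x (x ^ᶻ n) p∣)

primeFree⇒∣1 : ∀ g → (∀ p → Prime p → ¬ pos p ∣ g) → g ∣ 1ℤ
primeFree⇒∣1 g noPrime with ℤ.∣ g ∣ in eq
... | 0 = contradiction (subst (pos 2 ∣_) (sym (ℤ.∣i∣≡0⇒i≡0 eq)) ∣0) (noPrime 2 prime[2])
... | 1 = subst (g ∣_) (cong pos eq) m∣∣m∣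
... | n@(suc (suc _)) with factorise n
...   | record { factors = [] ; isFactorisation = () }
...   | record { factors = p ∷ ps ; isFactorisation = n≡ ; factorsPrime = pr ∷ _ } =
  contradiction (∣-trans (∣ᵤ⇒∣ (subst (p ℕ.∣_) (sym n≡) (ℕ.m∣m*n _))) (subst (λ k → pos k ∣ g) eq ∣m∣∣m)) (noPrime p pr)

primeFree⇒primitive : ∀ {n} (v : Fin n → ℤ) → (∀ p → Prime p → ¬ (∀ i → pos p ∣ v i)) → Primitive v
primeFree⇒primitive v noPrime K z all with content v
... | g , gc = ∣-trans (greatest gc K z all)
  (subst (z * g ∣_) (ℤ.*-identityʳ z) (*-monoʳ-∣ z g∣1))
  where
  g∣1 : g ∣ 1ℤ
  g∣1 = primeFree⇒∣1 g λ p pr p∣g → noPrime p pr λ i → ∣-trans p∣g (divisor gc i)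

-- Linear dependence over ℤ

sum-≡0 : ∀ {n} (f : Fin n → ℤ) → (∀ i → f i ≡ 0ℤ) → sum f ≡ 0ℤ
sum-≡0 {n} f f≡0 = trans (sum-cong-≗ f≡0) (sum-replicate-zero n)

∣-sum : ∀ {n K} (f : Fin n → ℤ) → (∀ i → K ∣ f i) → K ∣ sum f
∣-sum {zero}  f K∣f = ∣0
∣-sum {suc n} f K∣f = ∣m∣n⇒∣m+n (K∣f zero) (∣-sum (f ∘ suc) (K∣f ∘ suc))

sum-only : ∀ {n} (f : Fin n → ℤ) i → (∀ j → i ≢ j → f j ≡ 0ℤ) → sum f ≡ f i
sum-only {suc n} f i f≡0 = begin
  sum f                      ≡⟨ sum-remove {i = i} f ⟩
  f i + sum (f ∘ punchIn i)  ≡⟨ cong (f i +_) (sum-≡0 (f ∘ punchIn i) λ k → f≡0 (punchIn i k) (Fin.punchInᵢ≢i i k ∘ sym)) ⟩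
  f i + 0ℤ                   ≡⟨ ℤ.+-identityʳ (f i) ⟩
  f i                        ∎
  where open ≡-Reasoning

identity-≡ : ∀ {n} (i : Fin n) → identity i i ≡ 1ℤ
identity-≡ i with i Fin.≟ i
... | yes _  = refl
... | no i≢i = contradiction refl i≢i

identity-≢ : ∀ {n} {i j : Fin n} → i ≢ j → identity i j ≡ 0ℤ
identity-≢ {i = i} {j} i≢j with i Fin.≟ j
... | yes i≡j = contradiction i≡j i≢j
... | no _    = refl

infix 8 _∙_

_∙_ : ∀ {n} → (Fin n → ℤ) → (Fin n → ℤ) → ℤ
v ∙ w = sum λ i → v i * w i

identity-∙ : ∀ {n} i (v : Fin n → ℤ) → identity i ∙ v ≡ v i
identity-∙ i v = trans
  (sum-only (λ k → identity i k * v k) i λ k i≢k → trans (cong (_* v k) (identity-≢ i≢k)) (ℤ.*-zeroˡ (v k)))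
  (trans (cong (_* v i) (identity-≡ i)) (ℤ.*-identityˡ (v i)))

∙-identity : ∀ {n} j (v : Fin n → ℤ) → v ∙ (λ k → identity k j) ≡ v j
∙-identity j v = trans
  (sum-only (λ k → v k * identity k j) j λ k j≢k → trans (cong (v k *_) (identity-≢ (j≢k ∘ sym))) (ℤ.*-zeroʳ (v k)))
  (trans (cong (v j *_) (identity-≡ j)) (ℤ.*-identityʳ (v j)))

∙-linearʳ : ∀ {n} (u v w : Fin n → ℤ) a b → u ∙ (λ i → a * v i + b * w i) ≡ a * u ∙ v + b * u ∙ w
∙-linearʳ u v w a b = begin
  u ∙ (λ i → a * v i + b * w i)                              ≡⟨ sum-cong-≗ (λ i → lem (u i) a (v i) b (w i)) ⟩
  sum (λ i → a * (u i * v i) + b * (u i * w i))              ≡⟨ ∑-distrib-+ (λ i → a * (u i * v i)) (λ i → b * (u i * w i)) ⟩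
  sum (λ i → a * (u i * v i)) + sum (λ i → b * (u i * w i))  ≡⟨ cong₂ _+_ (*-distribˡ-sum a λ i → u i * v i) (*-distribˡ-sum b λ i → u i * w i) ⟨
  a * u ∙ v + b * u ∙ w                                      ∎
  where
  open ≡-Reasoning
  lem : ∀ u a v b w → u * (a * v + b * w) ≡ a * (u * v) + b * (u * w)
  lem = solve-∀

∙-comm : ∀ {n} (u v : Fin n → ℤ) → u ∙ v ≡ v ∙ u
∙-comm u v = sum-cong-≗ λ i → ℤ.*-comm (u i) (v i)

∙-linearˡ : ∀ {n} (u v w : Fin n → ℤ) a b → (λ i → a * v i + b * w i) ∙ u ≡ a * v ∙ u + b * w ∙ u
∙-linearˡ u v w a b = trans (∙-comm (λ i → a * v i + b * w i) u) (trans (∙-linearʳ u v w a b)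
  (cong₂ (λ x y → a * x + b * y) (∙-comm u v) (∙-comm u w)))

-- Fraction-free Gaussian elimination: a nonzero entry of the first row serves as pivot, and a zero
-- first row costs one equation and one unknown.
nonzeroKernel : ∀ n (M : Fin n → Fin (suc n) → ℤ) →
  ∃[ y ] (∀ i → M i ∙ y ≡ 0ℤ) × ∃[ b ] y b ≢ 0ℤ
nonzeroKernel zero    M = (λ _ → 1ℤ) , (λ ()) , zero , λ ()
nonzeroKernel (suc n) M with Fin.any? (λ b → ¬? (M zero b ℤ.≟ 0ℤ))
... | no none with nonzeroKernel n (λ i b → M (suc i) (suc b))
...   | y , My≡0 , b , yb≢0 = y⁺ , My⁺≡0 , suc b , yb≢0
  where
  y⁺ : Fin (suc (suc n)) → ℤ
  y⁺ zero    = 0ℤ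
  y⁺ (suc b) = y b
  M₀≡0 : ∀ b → M zero b ≡ 0ℤ
  M₀≡0 b = decidable-stable (M zero b ℤ.≟ 0ℤ) λ M≢0 → none (b , M≢0)
  My⁺≡0 : ∀ i → M i ∙ y⁺ ≡ 0ℤ
  My⁺≡0 zero    = sum-≡0 (λ b → M zero b * y⁺ b) λ b → trans (cong (_* y⁺ b) (M₀≡0 b)) (ℤ.*-zeroˡ (y⁺ b))
  My⁺≡0 (suc i) = trans (cong₂ _+_ (ℤ.*-zeroʳ (M (suc i) zero)) (My≡0 i)) refl
nonzeroKernel (suc n) M | yes (j , p≢0) with nonzeroKernel n
  (λ i k → M zero j * M (suc i) (punchIn j k) - M zero (punchIn j k) * M (suc i) j)
... | y , My≡0 , b , yb≢0 = y⁺ , My⁺≡0 , punchIn j b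
    , subst (_≢ 0ℤ) (sym (y⁺-punchIn b)) (*-≢0 p≢0 yb≢0)
  where
  open ≡-Reasoning
  p s : ℤ
  p = M zero j
  s = sum λ k → M zero (punchIn j k) * y k
  -- Scaling the solution of the reduced system by the pivot p keeps the pivot coordinate integral:
  -- the first equation forces it to be - s.
  y⁺ : Fin (suc (suc n)) → ℤ
  y⁺ = insertAt (λ k → p * y k) j (- s)
  y⁺-punchIn : ∀ k → y⁺ (punchIn j k) ≡ p * y k
  y⁺-punchIn = insertAt-punchIn (λ k → p * y k) j (- s)
  lem : ∀ r p t s y → r * (p * y) + - t * (s * y) ≡ (p * r - s * t) * y
  lem = solve-∀
  eliminated : ∀ r → r ∙ y⁺ ≡ sum λ k → (p * r (punchIn j k) - M zero (punchIn j k) * r j) * y k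
  eliminated r = begin
    r ∙ y⁺
      ≡⟨ sum-remove {i = j} (λ b → r b * y⁺ b) ⟩
    r j * y⁺ j + sum (λ k → r (punchIn j k) * y⁺ (punchIn j k))
      ≡⟨ cong₂ _+_ (cong (r j *_) (insertAt-lookup (λ k → p * y k) j (- s)))
                   (sum-cong-≗ λ k → cong (r (punchIn j k) *_) (y⁺-punchIn k)) ⟩
    r j * - s + sum (λ k → r (punchIn j k) * (p * y k))
      ≡⟨ ℤ.+-comm (r j * - s) (sum λ k → r (punchIn j k) * (p * y k)) ⟩
    sum (λ k → r (punchIn j k) * (p * y k)) + r j * - s
      ≡⟨ cong (sum (λ k → r (punchIn j k) * (p * y k)) +_) (trans (lem′ (r j) s) (*-distribˡ-sum (- r j) λ k → M zero (punchIn j k) * y k)) ⟩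
    sum (λ k → r (punchIn j k) * (p * y k)) + sum (λ k → - r j * (M zero (punchIn j k) * y k))
      ≡⟨ ∑-distrib-+ (λ k → r (punchIn j k) * (p * y k)) (λ k → - r j * (M zero (punchIn j k) * y k)) ⟨
    sum (λ k → r (punchIn j k) * (p * y k) + - r j * (M zero (punchIn j k) * y k))
      ≡⟨ sum-cong-≗ (λ k → lem (r (punchIn j k)) p (r j) (M zero (punchIn j k)) (y k)) ⟩
    sum (λ k → (p * r (punchIn j k) - M zero (punchIn j k) * r j) * y k) ∎
    where
    lem′ : ∀ r s → r * - s ≡ - r * s
    lem′ = solve-∀
  cancel : ∀ p q y → (p * q - q * p) * y ≡ 0ℤ
  cancel = solve-∀
  My⁺≡0 : ∀ i → M i ∙ y⁺ ≡ 0ℤ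
  My⁺≡0 zero    = trans (eliminated (M zero)) (sum-≡0 (λ k → (p * M zero (punchIn j k) - M zero (punchIn j k) * p) * y k) λ k → cancel p (M zero (punchIn j k)) (y k))
  My⁺≡0 (suc i) = trans (eliminated (M (suc i))) (My≡0 i)

∙-cancel-scale : ∀ {n g} {y w : Fin n → ℤ} → g ≢ 0ℤ → (∀ i → y i ≡ g * w i) →
  ∀ v → v ∙ y ≡ 0ℤ → v ∙ w ≡ 0ℤ
∙-cancel-scale {g = g} {y} {w} g≢0 y≡gw v vy≡0 = *-cancelˡ-≢0 g g≢0 (begin
  g * (v ∙ w)                  ≡⟨ *-distribˡ-sum g (λ b → v b * w b) ⟩
  sum (λ b → g * (v b * w b))  ≡⟨ sum-cong-≗ (λ b → trans (lem g (v b) (w b)) (cong (v b *_) (sym (y≡gw b)))) ⟩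
  v ∙ y                        ≡⟨ vy≡0 ⟩
  0ℤ                           ≡⟨ ℤ.*-zeroʳ g ⟨
  g * 0ℤ                       ∎)
  where
  open ≡-Reasoning
  lem : ∀ g m w → g * (m * w) ≡ m * (g * w)
  lem = solve-∀

primitiveKernel : ∀ n (M : Fin n → Fin (suc n) → ℤ) → ∃[ y ] (∀ i → M i ∙ y ≡ 0ℤ) × Primitive y
primitiveKernel n M = let y , My≡0 , b , yb≢0 = nonzeroKernel n M
                          g , w , g≢0 , y≡gw , prim = primitivePart y b yb≢0
                      in w , (λ i → ∙-cancel-scale g≢0 y≡gw (M i) (My≡0 i)) , prim

-- Families are indexed by ℕ and cut off at n, so that a family can grow by one vector without
-- reindexing.
∑< : ℕ → (ℕ → ℤ) → ℤ
∑< zero    f = 0ℤ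
∑< (suc n) f = ∑< n f + f n

∑<-cong : ∀ n {f g : ℕ → ℤ} → (∀ k → k ℕ.< n → f k ≡ g k) → ∑< n f ≡ ∑< n g
∑<-cong zero    f≡g = refl
∑<-cong (suc n) f≡g = cong₂ _+_ (∑<-cong n λ k k<n → f≡g k (ℕ.m<n⇒m<1+n k<n)) (f≡g n ℕ.≤-refl)

∑<-linear : ∀ n a b (f g : ℕ → ℤ) → ∑< n (λ k → a * f k + b * g k) ≡ a * ∑< n f + b * ∑< n g
∑<-linear zero    a b f g = lem a b
  where
  lem : ∀ a b → 0ℤ ≡ a * 0ℤ + b * 0ℤ
  lem = solve-∀
∑<-linear (suc n) a b f g = trans (cong (_+ (a * f n + b * g n)) (∑<-linear n a b f g)) (lem a b (∑< n f) (∑< n g) (f n) (g n))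
  where
  lem : ∀ a b F G f g → a * F + b * G + (a * f + b * g) ≡ a * (F + f) + b * (G + g)
  lem = solve-∀

∑<-head : ∀ n f → ∑< (suc n) f ≡ f 0 + ∑< n (f ∘ suc)
∑<-head zero    f = ℤ.+-comm 0ℤ (f 0)
∑<-head (suc n) f = trans (cong (_+ f (suc n)) (∑<-head n f)) (ℤ.+-assoc (f 0) (∑< n (f ∘ suc)) (f (suc n)))

∑<-sum : ∀ n f → ∑< n f ≡ sum {n} (f ∘ toℕ)
∑<-sum zero    f = refl
∑<-sum (suc n) f = trans (∑<-head n f) (cong (f 0 +_) (∑<-sum n (f ∘ suc)))

∣-∑< : ∀ n {K} f → (∀ k → k ℕ.< n → K ∣ f k) → K ∣ ∑< n f
∣-∑< zero    f K∣f = ∣0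
∣-∑< (suc n) f K∣f = ∣m∣n⇒∣m+n (∣-∑< n f λ k k<n → K∣f k (ℕ.m<n⇒m<1+n k<n)) (K∣f n ℕ.≤-refl)

∑<-≡0 : ∀ n f → (∀ k → k ℕ.< n → f k ≡ 0ℤ) → ∑< n f ≡ 0ℤ
∑<-≡0 n f f≡0 = 0∣⇒≡0 (∣-∑< n f λ k k<n → ∣-reflexive (sym (f≡0 k k<n)))

∑<-only : ∀ n f i → i ℕ.< n → (∀ k → k ℕ.< n → i ≢ k → f k ≡ 0ℤ) → ∑< n f ≡ f i
∑<-only (suc n) f i i<1+n f≡0 with i ℕ.≟ n
... | yes refl = trans (cong (_+ f n) (∑<-≡0 n f λ k k<n → f≡0 k (ℕ.m<n⇒m<1+n k<n) (ℕ.<⇒≢ k<n ∘ sym)))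
                       (ℤ.+-identityˡ (f n))
... | no i≢n = trans (cong₂ _+_ (∑<-only n f i (ℕ.≤∧≢⇒< (ℕ.≤-pred i<1+n) i≢n)
                                  λ k k<n → f≡0 k (ℕ.m<n⇒m<1+n k<n)) (f≡0 n ℕ.≤-refl i≢n))
                     (ℤ.+-identityʳ (f i))

∙-∑<ʳ : ∀ {m} n (v : Fin m → ℤ) (q : ℕ → ℤ) (u : ℕ → Fin m → ℤ) →
  v ∙ (λ x → ∑< n λ k → q k * u k x) ≡ ∑< n λ k → q k * v ∙ u k
∙-∑<ʳ zero    v q u = sum-≡0 (λ x → v x * 0ℤ) λ x → ℤ.*-zeroʳ (v x)
∙-∑<ʳ (suc n) v q u = begin
  v ∙ (λ x → S x + q n * u n x)                    ≡⟨ sum-cong-≗ (λ x → cong (λ t → v x * (t + q n * u n x)) (ℤ.*-identityˡ (S x))) ⟨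
  v ∙ (λ x → 1ℤ * S x + q n * u n x)               ≡⟨ ∙-linearʳ v S (u n) 1ℤ (q n) ⟩
  1ℤ * v ∙ S + q n * v ∙ u n                       ≡⟨ cong (_+ q n * v ∙ u n) (trans (ℤ.*-identityˡ (v ∙ S)) (∙-∑<ʳ n v q u)) ⟩
  (∑< n λ k → q k * v ∙ u k) + q n * v ∙ u n       ∎
  where
  open ≡-Reasoning
  S : _ → ℤ
  S x = ∑< n λ k → q k * u k x

extendByZero : ∀ {n} → (Fin n → ℤ) → ℕ → ℤ
extendByZero {n} v k with k ℕ.<? n
... | yes k<n = v (fromℕ< k<n)
... | no _    = 0ℤ

extendByZero-toℕ : ∀ {n} (v : Fin n → ℤ) i → extendByZero v (toℕ i) ≡ v i
extendByZero-toℕ {n} v i with toℕ i ℕ.<? n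
... | yes i<n = cong v (Fin.fromℕ<-toℕ i i<n)
... | no i≮n  = contradiction (Fin.toℕ<n i) i≮n

-- A dual basis with common denominator `scale`. It witnesses independence over ℚ quantitatively: a
-- combination divisible by K has coefficients divisible by K up to the factor `scale`, which is the
-- bounded loss δ of the later estimates.
record Independent {m} (u : ℕ → Fin m → ℤ) (n : ℕ) : Set where
  field
    scale        : ℤ
    scale≢0      : scale ≢ 0ℤ
    coordinate   : ℕ → Fin m → ℤ
    coordinate-≡ : ∀ k → k ℕ.< n → coordinate k ∙ u k ≡ scale
    coordinate-≢ : ∀ i k → i ℕ.< n → k ℕ.< n → i ≢ k → coordinate i ∙ u k ≡ 0ℤ

  coordinate-∑ : ∀ q i → i ℕ.< n → coordinate i ∙ (λ x → ∑< n λ k → q k * u k x) ≡ q i * scale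
  coordinate-∑ q i i<n = trans (∙-∑<ʳ n (coordinate i) q u)
    (trans (∑<-only n (λ k → q k * coordinate i ∙ u k) i i<n λ k k<n i≢k → trans (cong (q k *_) (coordinate-≢ i k i<n k<n i≢k)) (ℤ.*-zeroʳ (q k)))
           (cong (q i *_) (coordinate-≡ i i<n)))

  ∣-coefficients : ∀ K q → (∀ x → K ∣ ∑< n λ k → q k * u k x) → ∀ i → i ℕ.< n → K ∣ q i * scale
  ∣-coefficients K q K∣ i i<n = subst (K ∣_) (coordinate-∑ q i i<n)
    (∣-sum (λ x → coordinate i x * ∑< n λ k → q k * u k x) λ x → ∣n⇒∣m*n (coordinate i x) (K∣ x))

open Independent

Relation : ∀ {m} (u : ℕ → Fin m → ℤ) (n : ℕ) → Set
Relation u n = ∃[ a ] Σ[ b ∈ (ℕ → ℤ) ] a ≢ 0ℤ × (∀ x → a * u n x ≡ ∑< n λ k → b k * u k x)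

residual : ∀ {m} (u : ℕ → Fin m → ℤ) n → Independent u n → Fin m → ℤ
residual u n ind x = scale ind * u n x - ∑< n λ k → coordinate ind k ∙ u n * u k x

-- The residual is u n minus its projection to the span of the earlier vectors, cleared of
-- denominators. If it vanishes, it is the relation; otherwise a nonzero coordinate of it separates
-- u n from the span.
extend : ∀ {m} (u : ℕ → Fin m → ℤ) n → Independent u n → Relation u n ⊎ Independent u (suc n)
extend {m} u n ind with Fin.any? (λ x → ¬? (residual u n ind x ℤ.≟ 0ℤ))
... | no none = inj₁ (scale ind , (λ k → coordinate ind k ∙ u n) , scale≢0 ind
    , λ x → ℤ.i-j≡0⇒i≡j (scale ind * u n x) (∑< n λ k → coordinate ind k ∙ u n * u k x)
        (decidable-stable (residual u n ind x ℤ.≟ 0ℤ) λ wx≢0 → none (x , wx≢0)))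
... | yes (j , wj≢0) = inj₂ record
  { scale        = δ * w
  ; scale≢0      = *-≢0 (scale≢0 ind) wj≢0
  ; coordinate   = L
  ; coordinate-≡ = L-≡
  ; coordinate-≢ = L-≢
  }
  where
  open ≡-Reasoning
  δ w : ℤ
  δ = scale ind
  w = residual u n ind j
  -- The j-th coordinate functional, scaled by δ and corrected by its values on the earlier vectors:
  -- it kills u k for k < n and takes the value w on u n.
  ℓ : Fin m → ℤ
  ℓ x = δ * identity j x + -1ℤ * ∑< n λ k → u k j * coordinate ind k x
  ℓ∙ : ∀ v → ℓ ∙ v ≡ δ * v j - ∑< n λ k → u k j * coordinate ind k ∙ v
  ℓ∙ v = begin
    ℓ ∙ v                             ≡⟨ ∙-linearˡ v (identity j) c δ -1ℤ ⟩
    δ * identity j ∙ v + -1ℤ * c ∙ v           ≡⟨ cong₂ (λ s t → δ * s + t) (identity-∙ j v) (ℤ.-1*i≡-i (c ∙ v)) ⟩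
    δ * v j - c ∙ v                   ≡⟨ cong (λ t → δ * v j - t) c∙ ⟩
    δ * v j - (∑< n λ k → u k j * coordinate ind k ∙ v) ∎
    where
    c : Fin m → ℤ
    c x = ∑< n λ k → u k j * coordinate ind k x
    c∙ : c ∙ v ≡ ∑< n λ k → u k j * coordinate ind k ∙ v
    c∙ = trans (∙-comm c v) (trans (∙-∑<ʳ n v (λ k → u k j) (coordinate ind))
      (∑<-cong n λ k _ → cong (u k j *_) (∙-comm v (coordinate ind k))))
  ℓ∙u≡0 : ∀ i → i ℕ.< n → ℓ ∙ u i ≡ 0ℤ
  ℓ∙u≡0 i i<n = begin
    ℓ ∙ u i                                                  ≡⟨ ℓ∙ (u i) ⟩
    δ * u i j - (∑< n λ k → u k j * coordinate ind k ∙ u i)  ≡⟨ cong (λ t → δ * u i j - t) (∑<-only n (λ k → u k j * coordinate ind k ∙ u i) i i<n λ k k<n i≢k →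
                                                                 trans (cong (u k j *_) (coordinate-≢ ind k i k<n i<n (i≢k ∘ sym))) (ℤ.*-zeroʳ (u k j))) ⟩
    δ * u i j - u i j * coordinate ind i ∙ u i               ≡⟨ cong (λ t → δ * u i j - u i j * t) (coordinate-≡ ind i i<n) ⟩
    δ * u i j - u i j * δ                                    ≡⟨ lem δ (u i j) ⟩
    0ℤ                                                       ∎
    where
    lem : ∀ d u → d * u - u * d ≡ 0ℤ
    lem = solve-∀
  ℓ∙uₙ : ℓ ∙ u n ≡ w
  ℓ∙uₙ = trans (ℓ∙ (u n)) (cong (λ t → δ * u n j - t) (∑<-cong n λ k _ → ℤ.*-comm (u k j) (coordinate ind k ∙ u n)))
  -- The earlier functionals are corrected by multiples of ℓ so as to kill u n; the factors w and δ
  -- give all of them the common scale δ * w. The summand 0ℤ * ℓ only gives both cases the shape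
  -- required by `∙-linearˡ`.
  L : ℕ → Fin m → ℤ
  L i with i ℕ.≟ n
  ... | yes _ = λ x → δ * ℓ x + 0ℤ * ℓ x
  ... | no  _ = λ x → w * coordinate ind i x + - (coordinate ind i ∙ u n) * ℓ x
  lem₁ : ∀ d w → d * w + 0ℤ * w ≡ d * w
  lem₁ = solve-∀
  lem₂ : ∀ d w c → w * d + - c * 0ℤ ≡ d * w
  lem₂ = solve-∀
  lem₃ : ∀ w c → w * c + - c * w ≡ 0ℤ
  lem₃ = solve-∀
  lem₄ : ∀ w c → w * 0ℤ + - c * 0ℤ ≡ 0ℤ
  lem₄ = solve-∀
  below : ∀ {i} → i ℕ.< suc n → i ≢ n → i ℕ.< n
  below i<1+n i≢n = ℕ.≤∧≢⇒< (ℕ.≤-pred i<1+n) i≢n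
  L-≡ : ∀ k → k ℕ.< suc n → L k ∙ u k ≡ δ * w
  L-≡ k k<1+n with k ℕ.≟ n
  ... | yes refl = trans (∙-linearˡ (u k) ℓ ℓ δ 0ℤ) (trans (cong (λ t → δ * t + 0ℤ * t) ℓ∙uₙ) (lem₁ δ w))
  ... | no k≢n = trans (∙-linearˡ (u k) (coordinate ind k) ℓ w (- (coordinate ind k ∙ u n)))
    (trans (cong₂ (λ s t → w * s + - (coordinate ind k ∙ u n) * t) (coordinate-≡ ind k k<n) (ℓ∙u≡0 k k<n)) (lem₂ δ w (coordinate ind k ∙ u n)))
    where k<n = below k<1+n k≢n
  L-≢ : ∀ i k → i ℕ.< suc n → k ℕ.< suc n → i ≢ k → L i ∙ u k ≡ 0ℤ
  L-≢ i k i<1+n k<1+n i≢k with i ℕ.≟ n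
  ... | yes refl = trans (∙-linearˡ (u k) ℓ ℓ δ 0ℤ)
    (trans (cong (λ t → δ * t + 0ℤ * t) (ℓ∙u≡0 k (below k<1+n (i≢k ∘ sym)))) (trans (lem₁ δ 0ℤ) (ℤ.*-zeroʳ δ)))
  ... | no i≢n = trans (∙-linearˡ (u k) (coordinate ind i) ℓ w (- (coordinate ind i ∙ u n))) (values (k ℕ.≟ n))
    where
    values : Dec (k ≡ n) → w * coordinate ind i ∙ u k + - (coordinate ind i ∙ u n) * ℓ ∙ u k ≡ 0ℤ
    values (yes refl) = trans (cong (λ t → w * coordinate ind i ∙ u k + - (coordinate ind i ∙ u k) * t) ℓ∙uₙ) (lem₃ w (coordinate ind i ∙ u k))
    values (no k≢n) = trans (cong₂ (λ s t → w * s + - (coordinate ind i ∙ u n) * t)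
      (coordinate-≢ ind i k (below i<1+n i≢n) (below k<1+n k≢n) i≢k) (ℓ∙u≡0 k (below k<1+n k≢n))) (lem₄ w (coordinate ind i ∙ u n))

-- A primitive relation y among m + 1 vectors in ℤᵐ is tested by the coordinate functionals: every y
-- b * scale is 0, and primitivity with K = 0 makes the scale 0.
¬independent : ∀ {m} (u : ℕ → Fin m → ℤ) → ¬ Independent u (suc m)
¬independent {m} u ind = let y , uy≡0 , prim = primitiveKernel m (λ x b → u (toℕ b) x) in
  dependent y uy≡0 prim
  where
  dependent : ∀ y → (∀ x → (λ b → u (toℕ b) x) ∙ y ≡ 0ℤ) → ¬ Primitive y
  dependent y uy≡0 prim = scale≢0 ind (0∣⇒≡0 (prim 0ℤ (scale ind) λ b →
    subst (0ℤ ∣_) (trans (ℤ.*-comm (q (toℕ b)) (scale ind)) (cong (scale ind *_) (extendByZero-toℕ y b)))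
      (∣-coefficients ind 0ℤ q (λ x → ∣-reflexive (sym (vanishes x))) (toℕ b) (Fin.toℕ<n b))))
    where
    q = extendByZero y
    vanishes : ∀ x → (∑< (suc m) λ k → q k * u k x) ≡ 0ℤ
    vanishes x = trans (∑<-sum (suc m) (λ k → q k * u k x))
      (trans (sum-cong-≗ λ b → trans (cong (_* u (toℕ b) x) (extendByZero-toℕ y b)) (ℤ.*-comm (y b) (u (toℕ b) x))) (uy≡0 x))

-- Stopping at the first relation keeps the vectors before it independent. This lets divisibility of
-- u n be read off as divisibility of the coefficients of yⁿ.
firstRelation : ∀ {m} (u : ℕ → Fin m → ℤ) → ∃[ n ] Independent u n × Relation u n
firstRelation {m} u = search (suc m) 0 (ℕ.+-identityʳ (suc m)) record
  { scale = 1ℤ ; scale≢0 = λ () ; coordinate = λ _ _ → 0ℤ ; coordinate-≡ = λ _ () ; coordinate-≢ = λ _ _ () }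
  where
  search : ∀ fuel n → fuel ℕ.+ n ≡ suc m → Independent u n → ∃[ n ] Independent u n × Relation u n
  search zero       n refl ind = contradiction ind (¬independent u)
  search (suc fuel) n eq   ind with extend u n ind
  ... | inj₁ rel  = n , ind , rel
  ... | inj₂ ind⁺ = search fuel (suc n) (trans (ℕ.+-suc fuel n) eq) ind⁺

-- Determinants

det-cong : ∀ {n} {M N : Matrix n} → M ≈ N → det M ≡ det N
det-cong {zero}  M≈N = refl
det-cong {suc n} M≈N = sum-cong-≗ λ j →
  cong₂ (λ x y → -1ℤ ^ᶻ toℕ j * x * y) (M≈N zero j) (det-cong λ i k → M≈N (suc i) (punchIn j k))

-- Stated relationally, so that the induction can pass to the cofactors.
det-column : ∀ {n p} (b : Fin n) (x : Fin p → ℤ) (M : Fin p → Matrix n) (N : Matrix n) →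
  (∀ k i c → c ≢ b → N i c ≡ M k i c) → (∀ i → N i b ≡ sum (λ k → x k * M k i b)) →
  det N ≡ sum (λ k → x k * det (M k))
det-column {suc n} {p} b x M N off on = begin
  sum (λ c → σ c * N zero c * det (cofactor N c))
    ≡⟨ sum-cong-≗ (λ c → term c (c Fin.≟ b)) ⟩
  sum (λ c → sum λ k → x k * (σ c * M k zero c * det (cofactor (M k) c)))
    ≡⟨ ∑-comm (λ c k → x k * (σ c * M k zero c * det (cofactor (M k) c))) ⟩
  sum (λ k → sum λ c → x k * (σ c * M k zero c * det (cofactor (M k) c)))
    ≡⟨ sum-cong-≗ (λ k → *-distribˡ-sum (x k) λ c → σ c * M k zero c * det (cofactor (M k) c)) ⟨
  sum (λ k → x k * det (M k)) ∎
  where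
  open ≡-Reasoning
  σ : Fin (suc n) → ℤ
  σ c = -1ℤ ^ᶻ toℕ c
  cofactor : Matrix (suc n) → Fin (suc n) → Matrix n
  cofactor L c i k = L (suc i) (punchIn c k)
  lem₁ : ∀ x s m d → x * m * (s * d) ≡ x * (s * m * d)
  lem₁ = solve-∀
  lem₂ : ∀ x s m d → s * m * (x * d) ≡ x * (s * m * d)
  lem₂ = solve-∀
  lem₃ : ∀ s m d → s * m * d ≡ m * (s * d)
  lem₃ = solve-∀
  term : ∀ c → Dec (c ≡ b) → σ c * N zero c * det (cofactor N c) ≡
                             sum λ k → x k * (σ c * M k zero c * det (cofactor (M k) c))
  term c (yes refl) = begin
    σ c * N zero c * D                             ≡⟨ lem₃ (σ c) (N zero c) D ⟩
    N zero c * (σ c * D)                           ≡⟨ cong (_* (σ c * D)) (on zero) ⟩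
    sum (λ k → x k * M k zero c) * (σ c * D)       ≡⟨ *-distribʳ-sum (σ c * D) (λ k → x k * M k zero c) ⟩
    sum (λ k → x k * M k zero c * (σ c * D))       ≡⟨ sum-cong-≗ (λ k → trans (lem₁ (x k) (σ c) (M k zero c) D)
                                                        (cong (λ d → x k * (σ c * M k zero c * d)) (det-cong λ i l →
                                                          off k (suc i) (punchIn c l) (Fin.punchInᵢ≢i c l)))) ⟩
    sum (λ k → x k * (σ c * M k zero c * det (cofactor (M k) c))) ∎
    where
    D = det (cofactor N c)
  term c (no c≢b) = begin
    σ c * N zero c * det (cofactor N c)
      ≡⟨ cong (σ c * N zero c *_) (det-column (punchOut c≢b) x (λ k → cofactor (M k) c) (cofactor N c)
           (λ k i l l≢ → off k (suc i) (punchIn c l) λ eq → l≢ (Fin.punchIn-injective c l (punchOut c≢b)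
              (trans eq (sym (Fin.punchIn-punchOut c≢b)))))
           (λ i → subst (λ l → N (suc i) l ≡ sum (λ k → x k * M k (suc i) l)) (sym (Fin.punchIn-punchOut c≢b)) (on (suc i)))) ⟩
    σ c * N zero c * sum (λ k → x k * det (cofactor (M k) c))
      ≡⟨ *-distribˡ-sum (σ c * N zero c) (λ k → x k * det (cofactor (M k) c)) ⟩
    sum (λ k → σ c * N zero c * (x k * det (cofactor (M k) c)))
      ≡⟨ sum-cong-≗ (λ k → trans (lem₂ (x k) (σ c) (N zero c) (det (cofactor (M k) c)))
           (cong (λ m → x k * (σ c * m * det (cofactor (M k) c))) (off k zero c c≢b))) ⟩
    sum (λ k → x k * (σ c * M k zero c * det (cofactor (M k) c))) ∎

det-+ : ∀ {n} (b : Fin n) (N M₁ M₂ : Matrix n) →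
  (∀ i c → c ≢ b → N i c ≡ M₁ i c) → (∀ i c → c ≢ b → N i c ≡ M₂ i c) →
  (∀ i → N i b ≡ M₁ i b + M₂ i b) → det N ≡ det M₁ + det M₂
det-+ b N M₁ M₂ off₁ off₂ on = trans
  (det-column b (const 1ℤ) M N (λ { zero → off₁ ; (suc zero) → off₂ })
    (λ i → trans (on i) (sym (lem (M₁ i b) (M₂ i b)))))
  (lem (det M₁) (det M₂))
  where
  M : Fin 2 → Matrix _
  M zero    = M₁
  M (suc _) = M₂
  lem : ∀ x y → 1ℤ * x + (1ℤ * y + 0ℤ) ≡ x + y
  lem = solve-∀

Adjacent : ∀ {n} → Fin (suc n) → Fin n → Set
Adjacent c b = c ≡ inject₁ b ⊎ c ≡ suc b

-- In the Laplace expansion, deleting a column outside the pair leaves the pair adjacent, so the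
-- induction reaches that cofactor.
adjacentCofactor : ∀ {n} (b : Fin (suc n)) (c : Fin (suc (suc n))) → Adjacent c b ⊎
  ∃[ b′ ] punchIn c (inject₁ b′) ≡ inject₁ b × punchIn c (suc b′) ≡ suc b
adjacentCofactor zero zero = inj₁ (inj₁ refl)
adjacentCofactor zero (suc zero) = inj₁ (inj₂ refl)
adjacentCofactor {suc n} zero (suc (suc c)) = inj₂ (zero , refl , refl)
adjacentCofactor {suc n} (suc b) zero = inj₂ (b , refl , refl)
adjacentCofactor {suc n} (suc b) (suc c) with adjacentCofactor b c
... | inj₁ (inj₁ eq) = inj₁ (inj₁ (cong suc eq))
... | inj₁ (inj₂ eq) = inj₁ (inj₂ (cong suc eq))
... | inj₂ (b′ , eq₁ , eq₂) = inj₂ (suc b′ , cong suc eq₁ , cong suc eq₂)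

-- Deleting either column of an adjacent pair leaves the same list of columns, except that the
-- survivor of the pair differs. If the two columns are equal, so are the cofactors.
punchIn-adjacent : ∀ {n} (b k : Fin n) → punchIn (inject₁ b) k ≡ punchIn (suc b) k ⊎
  (punchIn (inject₁ b) k ≡ suc b × punchIn (suc b) k ≡ inject₁ b)
punchIn-adjacent zero    zero    = inj₂ (refl , refl)
punchIn-adjacent zero    (suc k) = inj₁ refl
punchIn-adjacent (suc b) zero    = inj₁ refl
punchIn-adjacent (suc b) (suc k) with punchIn-adjacent b k
... | inj₁ eq          = inj₁ (cong suc eq)
... | inj₂ (eq₁ , eq₂) = inj₂ (cong suc eq₁ , cong suc eq₂)

punchIn-inject₁ : ∀ {n} (b : Fin n) → punchIn (inject₁ b) b ≡ suc b
punchIn-inject₁ zero    = refl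
punchIn-inject₁ (suc b) = cong suc (punchIn-inject₁ b)

-- Only the two terms of the pair survive; they have equal cofactors and opposite signs.
det-adjacent : ∀ {n} (b : Fin n) (M : Matrix (suc n)) → (∀ i → M i (inject₁ b) ≡ M i (suc b)) → det M ≡ 0ℤ
det-adjacent {suc n} b M eq = begin
  sum T                                            ≡⟨ sum-remove {i = inject₁ b} T ⟩
  T (inject₁ b) + sum (T ∘ punchIn (inject₁ b))    ≡⟨ cong (T (inject₁ b) +_) (sum-only (T ∘ punchIn (inject₁ b)) b others) ⟩
  T (inject₁ b) + T (punchIn (inject₁ b) b)        ≡⟨ cong (λ c → T (inject₁ b) + T c) (punchIn-inject₁ b) ⟩
  T (inject₁ b) + T (suc b)                        ≡⟨ cong (_+ T (suc b)) first ⟩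
  σ * M zero (suc b) * D + -1ℤ * σ * M zero (suc b) * D  ≡⟨ lem σ (M zero (suc b)) D ⟩
  0ℤ                                               ∎
  where
  open ≡-Reasoning
  T : Fin (suc (suc n)) → ℤ
  T c = -1ℤ ^ᶻ toℕ c * M zero c * det (λ i k → M (suc i) (punchIn c k))
  σ D : ℤ
  σ = -1ℤ ^ᶻ toℕ b
  D = det (λ i k → M (suc i) (punchIn (suc b) k))
  lem : ∀ s m d → s * m * d + -1ℤ * s * m * d ≡ 0ℤ
  lem = solve-∀
  sameCofactor : ∀ i k → M (suc i) (punchIn (inject₁ b) k) ≡ M (suc i) (punchIn (suc b) k)
  sameCofactor i k = [ cong (M (suc i)) , (λ { (eq₁ , eq₂) →
    trans (cong (M (suc i)) eq₁) (trans (sym (eq (suc i))) (cong (M (suc i)) (sym eq₂))) }) ]′ (punchIn-adjacent b k)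
  first : T (inject₁ b) ≡ σ * M zero (suc b) * D
  first = cong₂ _*_ (cong₂ (λ t m → -1ℤ ^ᶻ t * m) (Fin.toℕ-inject₁ b) (eq zero)) (det-cong sameCofactor)
  zeroTerm : ∀ c → ¬ Adjacent c b → T c ≡ 0ℤ
  zeroTerm c ¬adj = [ (λ adj → contradiction adj ¬adj) , (λ { (b′ , eq₁ , eq₂) →
    trans (cong (-1ℤ ^ᶻ toℕ c * M zero c *_)
      (det-adjacent b′ (λ i k → M (suc i) (punchIn c k)) λ i →
        trans (cong (M (suc i)) eq₁) (trans (eq (suc i)) (cong (M (suc i)) (sym eq₂)))))
      (ℤ.*-zeroʳ (-1ℤ ^ᶻ toℕ c * M zero c)) }) ]′ (adjacentCofactor b c)
  others : ∀ k → b ≢ k → T (punchIn (inject₁ b) k) ≡ 0ℤ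
  others k b≢k = zeroTerm (punchIn (inject₁ b) k) [ Fin.punchInᵢ≢i (inject₁ b) k
    , (λ eq → b≢k (Fin.punchIn-injective (inject₁ b) b k (trans (punchIn-inject₁ b) (sym eq)))) ]′

setColumn : ∀ {r n} → (Fin r → Fin n → ℤ) → Fin n → (Fin r → ℤ) → Fin r → Fin n → ℤ
setColumn M c v i = updateAt (M i) c (const (v i))

setColumn-≡ : ∀ {r n} (M : Fin r → Fin n → ℤ) c v i → setColumn M c v i c ≡ v i
setColumn-≡ M c v i = updateAt-updates c (M i)

setColumn-≢ : ∀ {r n} (M : Fin r → Fin n → ℤ) c v i j → j ≢ c → setColumn M c v i j ≡ M i j
setColumn-≢ M c v i j j≢c = updateAt-minimal j c (M i) j≢c

-- Polarization, with t the number of columns strictly between b and c. Let x, y be the columns at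
-- c₀ and c₁, and z = x + y. Then `E z z` vanishes by adjacency and splits into `E x z` and `E y z`.
-- In `E y z` column b, which equals y, recurs at c₀, one step closer, so it vanishes by induction.
-- Splitting `E x z` into `E x x` and `E x y` leaves `E x y`, which is M.
det-distant : ∀ t {n} (M : Matrix (suc n)) b c → t ℕ.+ suc (toℕ b) ≡ toℕ c → (∀ i → M i b ≡ M i c) → det M ≡ 0ℤ
det-distant t M b zero dist eq = contradiction (trans (sym (ℕ.+-suc t (toℕ b))) dist) λ ()
det-distant zero M b (suc c) dist eq = det-adjacent c M λ i →
  trans (cong (M i) (Fin.toℕ-injective (trans (Fin.toℕ-inject₁ c) (sym (ℕ.suc-injective dist))))) (eq i)
det-distant (suc t) {suc n} M b (suc c) dist eq = begin
  det M                              ≡⟨ det-cong M≈ ⟩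
  det (E x y)                        ≡⟨ ℤ.+-identityˡ (det (E x y)) ⟨
  0ℤ + det (E x y)                   ≡⟨ cong (_+ det (E x y)) (det-adjacent c (E x x) λ i → trans (E-c₀ x x i) (sym (E-c₁ x x i))) ⟨
  det (E x x) + det (E x y)          ≡⟨ det-+ c₁ (E x z) (E x x) (E x y) (off₁ x z x) (off₁ x z y)
                                          (λ i → trans (E-c₁ x z i) (sym (cong₂ _+_ (E-c₁ x x i) (E-c₁ x y i)))) ⟨
  det (E x z)                        ≡⟨ ℤ.+-identityʳ (det (E x z)) ⟨
  det (E x z) + 0ℤ                   ≡⟨ cong (det (E x z) +_) (det-distant t (E y z) b c₀ dist₀ λ i →
                                          trans (E-off y z i b b≢c₀ b≢c₁) (trans (eq i) (sym (E-c₀ y z i)))) ⟨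
  det (E x z) + det (E y z)          ≡⟨ det-+ c₀ (E z z) (E x z) (E y z) (off₀ z x z) (off₀ z y z)
                                          (λ i → trans (E-c₀ z z i) (sym (cong₂ _+_ (E-c₀ x z i) (E-c₀ y z i)))) ⟨
  det (E z z)                        ≡⟨ det-adjacent c (E z z) (λ i → trans (E-c₀ z z i) (sym (E-c₁ z z i))) ⟩
  0ℤ                                 ∎
  where
  open ≡-Reasoning
  c₀ c₁ : Fin (suc (suc n))
  c₀ = inject₁ c
  c₁ = suc c
  x y z : Fin (suc (suc n)) → ℤ
  x i = M i c₀
  y i = M i c₁
  z i = x i + y i
  E : (v w : Fin (suc (suc n)) → ℤ) → Matrix (suc (suc n))
  E v w = setColumn (setColumn M c₀ v) c₁ w
  dist₀ : t ℕ.+ suc (toℕ b) ≡ toℕ c₀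
  dist₀ = trans (ℕ.suc-injective dist) (sym (Fin.toℕ-inject₁ c))
  b<c₀ : toℕ b ℕ.< toℕ c₀
  b<c₀ = subst (toℕ b ℕ.<_) dist₀ (ℕ.m≤n+m (suc (toℕ b)) t)
  b≢c₀ : b ≢ c₀
  b≢c₀ b≡ = ℕ.<⇒≢ b<c₀ (cong toℕ b≡)
  b≢c₁ : b ≢ c₁
  b≢c₁ b≡ = ℕ.<⇒≢ (ℕ.<-trans b<c₀ (ℕ.≤-reflexive (cong suc (Fin.toℕ-inject₁ c)))) (cong toℕ b≡)
  c₀≢c₁ : c₀ ≢ c₁
  c₀≢c₁ c₀≡ = ℕ.<⇒≢ (ℕ.≤-reflexive (cong suc (Fin.toℕ-inject₁ c))) (cong toℕ c₀≡)
  E-c₁ : ∀ v w i → E v w i c₁ ≡ w i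
  E-c₁ v w i = setColumn-≡ (setColumn M c₀ v) c₁ w i
  E-c₀ : ∀ v w i → E v w i c₀ ≡ v i
  E-c₀ v w i = trans (setColumn-≢ (setColumn M c₀ v) c₁ w i c₀ c₀≢c₁) (setColumn-≡ M c₀ v i)
  E-off : ∀ v w i j → j ≢ c₀ → j ≢ c₁ → E v w i j ≡ M i j
  E-off v w i j j≢c₀ j≢c₁ = trans (setColumn-≢ (setColumn M c₀ v) c₁ w i j j≢c₁) (setColumn-≢ M c₀ v i j j≢c₀)
  off₁ : ∀ v w w′ i j → j ≢ c₁ → E v w i j ≡ E v w′ i j
  off₁ v w w′ i j j≢c₁ = trans (setColumn-≢ (setColumn M c₀ v) c₁ w i j j≢c₁) (sym (setColumn-≢ (setColumn M c₀ v) c₁ w′ i j j≢c₁))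
  off₀ : ∀ v v′ w i j → j ≢ c₀ → E v w i j ≡ E v′ w i j
  off₀ v v′ w i j j≢c₀ with j Fin.≟ c₁
  ... | yes refl = trans (E-c₁ v w i) (sym (E-c₁ v′ w i))
  ... | no j≢c₁ = trans (E-off v w i j j≢c₀ j≢c₁) (sym (E-off v′ w i j j≢c₀ j≢c₁))
  M≈ : M ≈ E x y
  M≈ i j with j Fin.≟ c₀ | j Fin.≟ c₁
  ... | yes refl | _        = sym (E-c₀ x y i)
  ... | no _     | yes refl = sym (E-c₁ x y i)
  ... | no j≢c₀  | no j≢c₁  = sym (E-off x y i j j≢c₀ j≢c₁)

det-equalColumns : ∀ {n} (M : Matrix n) b c → b ≢ c → (∀ i → M i b ≡ M i c) → det M ≡ 0ℤ
det-equalColumns {suc n} M b c b≢c eq with ℕ.<-cmp (toℕ b) (toℕ c)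
... | tri≈ _ b≡c _ = contradiction (Fin.toℕ-injective b≡c) b≢c
... | tri< b<c _ _ = det-distant (toℕ c ℕ.∸ suc (toℕ b)) M b c (ℕ.m∸n+n≡m b<c) eq
... | tri> _ _ c<b = det-distant (toℕ b ℕ.∸ suc (toℕ c)) M c b (ℕ.m∸n+n≡m c<b) (sym ∘ eq)

-- Matrix algebra and inverses of unimodular matrices

∙-assoc : ∀ {p q} (w : Fin p → ℤ) (U : Fin p → Fin q → ℤ) (y : Fin q → ℤ) →
  w ∙ (λ i → U i ∙ y) ≡ (λ b → w ∙ (λ i → U i b)) ∙ y
∙-assoc w U y = begin
  sum (λ i → w i * sum (λ b → U i b * y b))    ≡⟨ sum-cong-≗ (λ i → *-distribˡ-sum (w i) λ b → U i b * y b) ⟩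
  sum (λ i → sum λ b → w i * (U i b * y b))    ≡⟨ ∑-comm (λ i b → w i * (U i b * y b)) ⟩
  sum (λ b → sum λ i → w i * (U i b * y b))    ≡⟨ sum-cong-≗ (λ b → trans (sum-cong-≗ λ i → sym (ℤ.*-assoc (w i) (U i b) (y b)))
                                                    (sym (*-distribʳ-sum (y b) λ i → w i * U i b))) ⟩
  sum (λ b → sum (λ i → w i * U i b) * y b)    ∎
  where open ≡-Reasoning

≈-trans : ∀ {m} {A B C : Matrix m} → A ≈ B → B ≈ C → A ≈ C
≈-trans A≈B B≈C i j = trans (A≈B i j) (B≈C i j)

≈-sym : ∀ {m} {A B : Matrix m} → A ≈ B → B ≈ A
≈-sym A≈B i j = sym (A≈B i j)

·-assoc : ∀ {m} (A B C : Matrix m) → A · (B · C) ≈ A · B · C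
·-assoc A B C i j = ∙-assoc (A i) B (λ k → C k j)

·-identityˡ : ∀ {m} (A : Matrix m) → identity · A ≈ A
·-identityˡ A i j = identity-∙ i (λ k → A k j)

·-identityʳ : ∀ {m} (A : Matrix m) → A · identity ≈ A
·-identityʳ A i j = ∙-identity j (A i)

·-congˡ : ∀ {m} (A : Matrix m) {B C} → B ≈ C → A · B ≈ A · C
·-congˡ A B≈C i j = sum-cong-≗ λ k → cong (A i k *_) (B≈C k j)

·-congʳ : ∀ {m} {A B : Matrix m} (C : Matrix m) → A ≈ B → A · C ≈ B · C
·-congʳ C A≈B i j = sum-cong-≗ λ k → cong (_* C k j) (A≈B i k)

·-cancelˡ : ∀ {m} (A B C : Matrix m) → A · B ≈ identity → A · (B · C) ≈ C
·-cancelˡ A B C AB≈1 = ≈-trans (·-assoc A B C) (≈-trans (·-congʳ C AB≈1) (·-identityˡ C))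

·-cancelʳ : ∀ {m} (A B C : Matrix m) → A · B ≈ identity → C · A · B ≈ C
·-cancelʳ A B C AB≈1 = ≈-trans (≈-sym (·-assoc C A B)) (≈-trans (·-congˡ C AB≈1) (·-identityʳ C))

-- Replacing column j by a unit vector gives the signed cofactor without handling signs.
adjugate : ∀ {m} → Matrix m → Matrix m
adjugate U j i = det (setColumn U j λ r → identity r i)

-- Both sides are the determinant of U with column j replaced by column l: expand that column in
-- unit vectors for the left side, and use equal columns for the right side when j and l differ.
cramer : ∀ {m} (U : Matrix m) j l → (adjugate U · U) j l ≡ det U * identity j l
cramer U j l = begin
  sum (λ i → adjugate U j i * U i l)        ≡⟨ sum-cong-≗ (λ i → ℤ.*-comm (adjugate U j i) (U i l)) ⟩
  sum (λ i → U i l * adjugate U j i)        ≡⟨ det-column j (λ i → U i l) (λ i → setColumn U j λ r → identity r i) V off on ⟨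
  det V                                     ≡⟨ value (j Fin.≟ l) ⟩
  det U * identity j l                      ∎
  where
  open ≡-Reasoning
  V = setColumn U j λ r → U r l
  off : ∀ i r c → c ≢ j → V r c ≡ setColumn U j (λ r → identity r i) r c
  off i r c c≢j = trans (setColumn-≢ U j (λ r → U r l) r c c≢j) (sym (setColumn-≢ U j (λ r → identity r i) r c c≢j))
  on : ∀ r → V r j ≡ sum λ i → U i l * setColumn U j (λ r → identity r i) r j
  on r = trans (setColumn-≡ U j (λ r → U r l) r) (sym (trans
    (sum-cong-≗ λ i → trans (cong (U i l *_) (setColumn-≡ U j (λ r → identity r i) r)) (ℤ.*-comm (U i l) (identity r i)))
    (identity-∙ r λ i → U i l)))
  value : Dec (j ≡ l) → det V ≡ det U * identity j l
  value (yes refl) = trans (det-cong V≈U) (trans (sym (ℤ.*-identityʳ (det U))) (cong (det U *_) (sym (identity-≡ j))))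
    where
    V≈U : V ≈ U
    V≈U r c with c Fin.≟ j
    ... | yes refl = setColumn-≡ U j (λ r → U r j) r
    ... | no c≢j   = setColumn-≢ U j (λ r → U r j) r c c≢j
  value (no j≢l) = trans
    (det-equalColumns V j l j≢l λ r → trans (setColumn-≡ U j (λ r → U r l) r)
      (sym (setColumn-≢ U j (λ r → U r l) r l (j≢l ∘ sym))))
    (trans (sym (ℤ.*-zeroʳ (det U))) (cong (det U *_) (sym (identity-≢ j≢l))))

leftInverse : ∀ {m} (U : Matrix m) → Unimodular U → ∃[ W ] W · U ≈ identity
leftInverse {m} U unimodular = W , W·U≈1
  where
  open ≡-Reasoning
  -- As det U is 1 or -1, it is its own inverse.
  W : Matrix m
  W j i = det U * adjugate U j i
  square : det U * det U ≡ 1ℤ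
  square = [ (λ eq → cong (λ d → d * d) eq) , (λ eq → cong (λ d → d * d) eq) ]′ unimodular
  W·U≈1 : W · U ≈ identity
  W·U≈1 j l = begin
    sum (λ i → det U * adjugate U j i * U i l)     ≡⟨ sum-cong-≗ (λ i → ℤ.*-assoc (det U) (adjugate U j i) (U i l)) ⟩
    sum (λ i → det U * (adjugate U j i * U i l))   ≡⟨ *-distribˡ-sum (det U) (λ i → adjugate U j i * U i l) ⟨
    det U * (adjugate U · U) j l                   ≡⟨ cong (det U *_) (cramer U j l) ⟩
    det U * (det U * identity j l)                 ≡⟨ ℤ.*-assoc (det U) (det U) (identity j l) ⟨
    det U * det U * identity j l                   ≡⟨ cong (_* identity j l) square ⟩
    1ℤ * identity j l                              ≡⟨ ℤ.*-identityˡ (identity j l) ⟩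
    identity j l                                   ∎

-- The columns of U together with any unit vector are m + 1 vectors in ℤᵐ, hence linearly dependent;
-- applying W to the dependence determines its coefficients.
leftInverse⇒rightInverse : ∀ {m} (W U : Matrix m) → W · U ≈ identity → U · W ≈ identity
leftInverse⇒rightInverse {m} W U WU≈1 i₀ l =
  let y , My≡0 , prim = primitiveKernel m M in solve y My≡0 prim i₀
  where
  open ≡-Reasoning
  M : Fin m → Fin (suc m) → ℤ
  M i zero    = identity i l
  M i (suc b) = U i b
  solve : ∀ y → (∀ i → M i ∙ y ≡ 0ℤ) → Primitive y → ∀ i → (U · W) i l ≡ identity i l
  solve y My≡0 prim i = *-cancelˡ-≢0 y₀ y₀≢0 (ℤ.i-j≡0⇒i≡j (y₀ * (U · W) i l) (y₀ * identity i l) (begin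
    y₀ * (U · W) i l - y₀ * identity i l
      ≡⟨ lem₁ y₀ ((U · W) i l) (identity i l) ⟩
    - (identity i l * y₀ + - y₀ * (U · W) i l)
      ≡⟨ cong (λ t → - (identity i l * y₀ + t)) (trans (*-distribˡ-sum (- y₀) λ b → U i b * W b l)
           (sum-cong-≗ λ b → trans (lem₂ (- y₀) (U i b) (W b l)) (cong (U i b *_) (sym (tail≡ b))))) ⟩
    - (M i ∙ y)
      ≡⟨ cong -_ (My≡0 i) ⟩
    0ℤ ∎))
    where
    lem₁ : ∀ y a b → y * a - y * b ≡ - (b * y + - y * a)
    lem₁ = solve-∀
    lem₂ : ∀ y a b → y * (a * b) ≡ a * (y * b)
    lem₂ = solve-∀
    lem₃ : ∀ y w t → t ≡ - y * w + (y * w + 1ℤ * t)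
    lem₃ = solve-∀
    y₀ : ℤ
    y₀ = y zero
    y⁺ : Fin m → ℤ
    y⁺ b = y (suc b)
    tail≡ : ∀ k → y⁺ k ≡ - y₀ * W k l
    tail≡ k = begin
      y⁺ k                                                    ≡⟨ lem₃ y₀ (W k l) (y⁺ k) ⟩
      - y₀ * W k l + (y₀ * W k l + 1ℤ * y⁺ k)                 ≡⟨ cong₂ (λ s t → - y₀ * W k l + (y₀ * s + 1ℤ * t)) (∙-identity l (W k))
                                                                   (trans (sum-cong-≗ λ b → cong (_* y⁺ b) (WU≈1 k b)) (identity-∙ k y⁺)) ⟨
      - y₀ * W k l + (y₀ * W k ∙ (λ i → identity i l) + 1ℤ * (λ b → W k ∙ (λ i → U i b)) ∙ y⁺)
        ≡⟨ cong (λ t → - y₀ * W k l + (y₀ * W k ∙ (λ i → identity i l) + 1ℤ * t)) (∙-assoc (W k) U y⁺) ⟨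
      - y₀ * W k l + (y₀ * W k ∙ (λ i → identity i l) + 1ℤ * W k ∙ (λ i → U i ∙ y⁺))
        ≡⟨ cong (- y₀ * W k l +_) (∙-linearʳ (W k) (λ i → identity i l) (λ i → U i ∙ y⁺) y₀ 1ℤ) ⟨
      - y₀ * W k l + W k ∙ (λ i → y₀ * identity i l + 1ℤ * U i ∙ y⁺)
        ≡⟨ cong (- y₀ * W k l +_) (sum-≡0 (λ i → W k i * (y₀ * identity i l + 1ℤ * U i ∙ y⁺)) λ i → trans
             (cong (W k i *_) (trans (cong₂ _+_ (ℤ.*-comm y₀ (identity i l)) (ℤ.*-identityˡ (U i ∙ y⁺))) (My≡0 i))) (ℤ.*-zeroʳ (W k i))) ⟩
      - y₀ * W k l + 0ℤ                                       ≡⟨ ℤ.+-identityʳ (- y₀ * W k l) ⟩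
      - y₀ * W k l                                            ∎
    y₀≢0 : y₀ ≢ 0ℤ
    y₀≢0 y₀≡0 = contradiction (0∣⇒≡0 (prim 0ℤ 1ℤ λ { zero → vanish y₀≡0 ; (suc k) → vanish (trans (tail≡ k)
      (trans (cong (λ t → - t * W k l) y₀≡0) (ℤ.*-zeroˡ (W k l)))) })) λ ()
      where
      vanish : ∀ {t} → t ≡ 0ℤ → 0ℤ ∣ 1ℤ * t
      vanish refl = ∣0

inverse : ∀ {m} (U : Matrix m) → Unimodular U → ∃[ W ] W · U ≈ identity × U · W ≈ identity
inverse U unimodular = let W , WU≈1 = leftInverse U unimodular in W , WU≈1 , leftInverse⇒rightInverse W U WU≈1

-- Minors

sum-↑ : ∀ m {n} (f : Fin (m ℕ.+ n) → ℤ) → sum f ≡ sum (λ i → f (i ↑ˡ n)) + sum (λ i → f (m ↑ʳ i))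
sum-↑ zero    f = sym (ℤ.+-identityˡ (sum f))
sum-↑ (suc m) {n} f = trans (cong (f zero +_) (sum-↑ m (f ∘ suc)))
  (sym (ℤ.+-assoc (f zero) (sum λ i → f (suc (i ↑ˡ n))) (sum λ i → f (suc (m ↑ʳ i)))))

sum-combine : ∀ m n (f : Fin (m ℕ.* n) → ℤ) → sum f ≡ sum {m} λ i → sum λ j → f (combine i j)
sum-combine zero    n f = refl
sum-combine (suc m) n f = trans (sum-↑ n f)
  (cong (sum (λ j → f (j ↑ˡ (m ℕ.* n))) +_) (sum-combine m n λ x → f (n ↑ʳ x)))

-- Multilinearity in the rows. Summing over all choice functions, not only increasing ones, gives a
-- linear map on minors free of sorting and signs.
det-rows : ∀ {j p} (α : Fin j → Fin p → ℤ) (w : Fin p → Fin j → ℤ) →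
  det (λ a b → α a ∙ (λ k → w k b)) ≡
  sum {p ℕ.^ j} λ K → ∏ (λ a → α a (finToFun K a)) * det (λ a b → w (finToFun K a) b)
det-rows {zero}  α w = refl
det-rows {suc j} {p} α w = begin
  sum (λ c → σ c * α zero ∙ (λ k → w k c) * det (λ a b → α (suc a) ∙ (λ k → w k (punchIn c b))))
    ≡⟨ sum-cong-≗ (λ c → cong (σ c * α zero ∙ (λ k → w k c) *_) (det-rows (α ∘ suc) (λ k b → w k (punchIn c b)))) ⟩
  sum (λ c → σ c * α zero ∙ (λ k → w k c) * sum λ K → π K * D c K)
    ≡⟨ sum-cong-≗ {suc j} expand ⟩
  sum (λ c → sum λ k → sum λ K → α zero k * π K * (σ c * w k c * D c K))
    ≡⟨ ∑-comm (λ c k → sum λ K → α zero k * π K * (σ c * w k c * D c K)) ⟩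
  sum (λ k → sum λ c → sum λ K → α zero k * π K * (σ c * w k c * D c K))
    ≡⟨ sum-cong-≗ {p} (λ k → ∑-comm (λ c K → α zero k * π K * (σ c * w k c * D c K))) ⟩
  sum (λ k → sum λ K → sum λ c → α zero k * π K * (σ c * w k c * D c K))
    ≡⟨ sum-cong-≗ {p} (λ k → sum-cong-≗ {p ℕ.^ j} λ K → trans
         (sym (*-distribˡ-sum (α zero k * π K) λ c → σ c * w k c * D c K)) (F-combine k K)) ⟩
  sum {p} (λ k → sum {p ℕ.^ j} λ K → F (combine k K))
    ≡⟨ sum-combine p (p ℕ.^ j) F ⟨
  sum F ∎
  where
  open ≡-Reasoning
  σ : Fin (suc j) → ℤ
  σ c = -1ℤ ^ᶻ toℕ c
  π : Fin (p ℕ.^ j) → ℤ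
  π K = ∏ λ a → α (suc a) (finToFun K a)
  D : Fin (suc j) → Fin (p ℕ.^ j) → ℤ
  D c K = det λ a b → w (finToFun K a) (punchIn c b)
  F : Fin (p ℕ.* p ℕ.^ j) → ℤ
  F K = ∏ (λ a → α a (finToFun {p} {suc j} K a)) * det (λ a b → w (finToFun {p} {suc j} K a) b)
  lem : ∀ s a w P d → s * (a * w) * (P * d) ≡ a * P * (s * w * d)
  lem = solve-∀
  expand : ∀ c → σ c * α zero ∙ (λ k → w k c) * sum (λ K → π K * D c K) ≡
                 sum λ k → sum λ K → α zero k * π K * (σ c * w k c * D c K)
  expand c = begin
    σ c * α zero ∙ (λ k → w k c) * Σπ
      ≡⟨ cong (_* Σπ) (*-distribˡ-sum (σ c) λ k → α zero k * w k c) ⟩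
    sum (λ k → σ c * (α zero k * w k c)) * Σπ
      ≡⟨ *-distribʳ-sum Σπ (λ k → σ c * (α zero k * w k c)) ⟩
    sum (λ k → σ c * (α zero k * w k c) * Σπ)
      ≡⟨ sum-cong-≗ {p} (λ k → trans (*-distribˡ-sum (σ c * (α zero k * w k c)) λ K → π K * D c K)
           (sum-cong-≗ {p ℕ.^ j} λ K → lem (σ c) (α zero k) (w k c) (π K) (D c K))) ⟩
    sum (λ k → sum λ K → α zero k * π K * (σ c * w k c * D c K)) ∎
    where
    Σπ = sum λ K → π K * D c K
  F-combine : ∀ k K → α zero k * π K * sum (λ c → σ c * w k c * D c K) ≡ F (combine k K)
  F-combine k K = cong₂ _*_
    (cong₂ _*_ (cong (α zero) (sym head≡)) (∏.sum-cong-≗ λ a → cong (α (suc a)) (sym (tail≡ a))))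
    (sum-cong-≗ λ c → cong₂ (λ x d → σ c * x * d) (cong (λ x → w x c) (sym head≡))
      (det-cong λ a b → cong (λ x → w x (punchIn c b)) (sym (tail≡ a))))
    where
    head≡ : finToFun {p} {suc j} (combine k K) zero ≡ k
    head≡ = cong proj₁ (Fin.remQuot-combine {p} k K)
    tail≡ : ∀ a → finToFun {p} {suc j} (combine k K) (suc a) ≡ finToFun K a
    tail≡ a = cong (λ r → finToFun {p} {j} (proj₂ r) a) (Fin.remQuot-combine {p} k K)

-- Row and column selections are arbitrary maps: a repetition gives 0 and a permutation only changes
-- the sign, so the gcd is the classical determinantal divisor.
minor : ∀ {m j} → Matrix m → (Fin j → Fin m) → (Fin j → Fin m) → ℤ
minor M I J = det λ a b → M (I a) (J b)

minor-congᵢ : ∀ {m j} (M : Matrix m) {I I′ J J′ : Fin j → Fin m} →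
  (∀ a → I a ≡ I′ a) → (∀ b → J b ≡ J′ b) → minor M I J ≡ minor M I′ J′
minor-congᵢ M I≡ J≡ = det-cong λ a b → cong₂ M (I≡ a) (J≡ b)

minor-cong : ∀ {m j} {M N : Matrix m} (I J : Fin j → Fin m) → M ≈ N → minor M I J ≡ minor N I J
minor-cong I J M≈N = det-cong λ a b → M≈N (I a) (J b)

minor-· : ∀ {m j} (A M : Matrix m) (I J : Fin j → Fin m) →
  minor (A · M) I J ≡ sum {m ℕ.^ j} λ K → ∏ (λ a → A (I a) (finToFun K a)) * minor M (finToFun K) J
minor-· A M I J = det-rows (A ∘ I) (λ k b → M k (J b))

∣-*-∙ : ∀ {n K} z (x d : Fin n → ℤ) → (∀ k → K ∣ z * d k) → K ∣ z * x ∙ d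
∣-*-∙ {K = K} z x d K∣ = subst (K ∣_) (sym (*-distribˡ-sum z λ k → x k * d k))
  (∣-sum (λ k → z * (x k * d k)) λ k → subst (K ∣_) (lem z (x k) (d k)) (∣n⇒∣m*n (x k) (K∣ k)))
  where
  lem : ∀ z x d → x * (z * d) ≡ z * (x * d)
  lem = solve-∀

∣-minor-·ˡ : ∀ {m j K} z (A M : Matrix m) → (∀ (I J : Fin j → Fin m) → K ∣ z * minor M I J) →
  ∀ I J → K ∣ z * minor (A · M) I J
∣-minor-·ˡ {m} {j} {K} z A M K∣ I J = subst (λ d → K ∣ z * d) (sym (minor-· A M I J))
  (∣-*-∙ z (λ L → ∏ λ a → A (I a) (finToFun L a)) (λ L → minor M (finToFun L) J) λ L → K∣ (finToFun L) J)

-- The columns of index at least t are unit combinations; they are released one at a time.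
∣-det-columns : ∀ {j p K} z (v : Fin j → Fin p → ℤ) → (∀ (J : Fin j → Fin p) → K ∣ z * det (λ a b → v a (J b))) →
  ∀ t (C : Fin j → Fin p → ℤ) → (∀ b → t ℕ.≤ toℕ b → ∃[ k ] (∀ i → C b i ≡ identity k i)) →
  K ∣ z * det (λ a b → C b ∙ v a)
∣-det-columns {K = K} z v K∣ zero C unit = subst (λ d → K ∣ z * d)
  (det-cong λ a b → sym (trans (sum-cong-≗ λ i → cong (_* v a i) (proj₂ (unit b z≤n) i)) (identity-∙ (proj₁ (unit b z≤n)) (v a))))
  (K∣ λ b → proj₁ (unit b z≤n))
∣-det-columns {j} {p} {K} z v K∣ (suc t) C unit with t ℕ.<? j
... | no t≮j = ∣-det-columns z v K∣ t C λ b t≤b → contradiction (ℕ.≤-<-trans t≤b (Fin.toℕ<n b)) t≮j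
... | yes t<j = subst (λ d → K ∣ z * d)
  (sym (det-column c (C c) (λ k a b → Cᵏ k b ∙ v a) (λ a b → C b ∙ v a)
    (λ k a b b≢c → cong (_∙ v a) (sym (updateAt-minimal b c C b≢c)))
    (λ a → sum-cong-≗ λ k → cong (C c k *_) (sym (trans (cong (_∙ v a) (updateAt-updates c C)) (identity-∙ k (v a)))))))
  (∣-*-∙ z (C c) (λ k → det λ a b → Cᵏ k b ∙ v a) λ k → ∣-det-columns z v K∣ t (Cᵏ k) (unitᵏ k))
  where
  c : Fin j
  c = fromℕ< t<j
  Cᵏ : Fin p → Fin j → Fin p → ℤ
  Cᵏ k = updateAt C c (const (identity k))
  unitᵏ : ∀ k b → t ℕ.≤ toℕ b → ∃[ l ] (∀ i → Cᵏ k b i ≡ identity l i)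
  unitᵏ k b t≤b with b Fin.≟ c
  ... | yes refl = k , λ i → cong (λ f → f i) (updateAt-updates c C)
  ... | no b≢c = let l , eq = unit b (ℕ.≤∧≢⇒< t≤b λ t≡b → b≢c (Fin.toℕ-injective (trans (sym t≡b) (sym (Fin.toℕ-fromℕ< t<j)))))
                 in l , λ i → trans (cong (λ f → f i) (updateAt-minimal b c C b≢c)) (eq i)

∣-minor-·ʳ : ∀ {m j K} z (M V : Matrix m) → (∀ (I J : Fin j → Fin m) → K ∣ z * minor M I J) →
  ∀ I J → K ∣ z * minor (M · V) I J
∣-minor-·ʳ {m} {j} {K} z M V K∣ I J = subst (λ d → K ∣ z * d)
  (det-cong λ a b → ∙-comm (λ k → V k (J b)) (M (I a)))
  -- At t = j every column is still free, so the condition on unit columns is vacuous.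
  (∣-det-columns z (M ∘ I) (K∣ I) j (λ b k → V k (J b)) λ b j≤b → contradiction (Fin.toℕ<n b) (ℕ.≤⇒≯ j≤b))

∏-∣-det : ∀ {n} (x : Fin n → ℤ) (M : Matrix n) → (∀ a b → x b ∣ M a b) → ∏ x ∣ det M
∏-∣-det {zero}  x M x∣M = ∣-refl
∏-∣-det {suc n} x M x∣M = ∣-sum (λ c → -1ℤ ^ᶻ toℕ c * M zero c * det (λ i k → M (suc i) (punchIn c k))) λ c →
  subst (_∣ -1ℤ ^ᶻ toℕ c * M zero c * det (λ i k → M (suc i) (punchIn c k))) (sym (∏.sum-remove {i = c} x))
    (*-mono-∣ {x c} {_} {∏ (x ∘ punchIn c)} (∣n⇒∣m*n (-1ℤ ^ᶻ toℕ c) (x∣M zero c)) (∏-∣-det (x ∘ punchIn c) _ λ a b → x∣M (suc a) (punchIn c b)))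

det-diagonal : ∀ {n} (M : Matrix n) → Diagonal M → det M ≡ ∏ (λ a → M a a)
det-diagonal {zero}  M diag = refl
det-diagonal {suc n} M diag = trans
  (sum-only (λ c → -1ℤ ^ᶻ toℕ c * M zero c * det (λ i k → M (suc i) (punchIn c k))) zero λ c 0≢c →
    trans (cong (λ t → -1ℤ ^ᶻ toℕ c * t * det (λ i k → M (suc i) (punchIn c k))) (diag zero c 0≢c))
          (lem (-1ℤ ^ᶻ toℕ c) (det λ i k → M (suc i) (punchIn c k))))
  (cong₂ _*_ (ℤ.*-identityˡ (M zero zero))
    (det-diagonal (λ i k → M (suc i) (suc k)) λ a b a≢b → diag (suc a) (suc b) (a≢b ∘ Fin.suc-injective)))
  where
  lem : ∀ s d → s * 0ℤ * d ≡ 0ℤ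
  lem = solve-∀

-- Smith forms

∏< : ℕ → (ℕ → ℤ) → ℤ
∏< zero    f = 1ℤ
∏< (suc n) f = ∏< n f * f n

∏<-head : ∀ n f → ∏< (suc n) f ≡ f 0 * ∏< n (f ∘ suc)
∏<-head zero    f = ℤ.*-comm 1ℤ (f 0)
∏<-head (suc n) f = trans (cong (_* f (suc n)) (∏<-head n f)) (ℤ.*-assoc (f 0) (∏< n (f ∘ suc)) (f (suc n)))

∏<-∏ : ∀ n f → ∏< n f ≡ ∏ {n} (f ∘ toℕ)
∏<-∏ zero    f = refl
∏<-∏ (suc n) f = trans (∏<-head n f) (cong (f 0 *_) (∏<-∏ n (f ∘ suc)))

∣-chain : ∀ (f : ℕ → ℤ) → (∀ k → f k ∣ f (suc k)) → ∀ {k l} → k ℕ.≤ l → f k ∣ f l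
∣-chain f step {l = zero}  z≤n = ∣-refl
∣-chain f step {k} {suc l} k≤1+l with k ℕ.≟ suc l
... | yes refl = ∣-refl
... | no k≢1+l = ∣-trans (∣-chain f step (ℕ.≤-pred (ℕ.≤∧≢⇒< k≤1+l k≢1+l))) (step l)

-- Among n + 1 distinct indices one is at least n, by the pigeonhole principle. It accounts for the
-- factor f n, and the others are left to the induction.
∏<-∣-∏ : ∀ (f : ℕ → ℤ) → (∀ {k l} → k ℕ.≤ l → f k ∣ f l) →
  ∀ n (J : Fin n → ℕ) → (∀ {b c} → J b ≡ J c → b ≡ c) → ∏< n f ∣ ∏ (f ∘ J)
∏<-∣-∏ f mono zero    J inj = ∣-refl
∏<-∣-∏ f mono (suc n) J inj with Fin.any? (λ b → n ℕ.≤? J b)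
... | yes (b , n≤Jb) = subst (∏< (suc n) f ∣_)
  (trans (ℤ.*-comm (∏ (f ∘ J ∘ punchIn b)) (f (J b))) (sym (∏.sum-remove {i = b} (f ∘ J))))
  (*-mono-∣ {∏< n f} {_} {f n} (∏<-∣-∏ f mono n (J ∘ punchIn b) λ eq → Fin.punchIn-injective b _ _ (inj eq)) (mono n≤Jb))
... | no none with Fin.pigeonhole (ℕ.n<1+n n) (λ b → fromℕ< (ℕ.≰⇒> λ n≤Jb → none (b , n≤Jb)))
...   | b , c , b<c , eq = contradiction
  (cong toℕ (inj (trans (sym (Fin.toℕ-fromℕ< _)) (trans (cong toℕ eq) (Fin.toℕ-fromℕ< _))))) (ℕ.<⇒≢ b<c)

-- Padding the diagonal with 0 prolongs the divisibility chain to all of ℕ, since everything divides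
-- 0.
entry : ∀ {m} → Matrix m → ℕ → ℤ
entry S = extendByZero λ i → S i i

entry-toℕ : ∀ {m} (S : Matrix m) i → entry S (toℕ i) ≡ S i i
entry-toℕ S = extendByZero-toℕ λ i → S i i

entry-step : ∀ {m} {M S : Matrix m} → IsSmithForm M S → ∀ k → entry S k ∣ entry S (suc k)
entry-step {m} {M} {S} smith k with suc k ℕ.<? m
... | no _     = ∣0
... | yes 1+k<m = subst (_∣ S (fromℕ< 1+k<m) (fromℕ< 1+k<m))
  (trans (sym (entry-toℕ S (fromℕ< k<m))) (cong (entry S) (Fin.toℕ-fromℕ< k<m)))
  (IsSmithForm.divisibility smith (fromℕ< k<m) (fromℕ< 1+k<m)
    (trans (Fin.toℕ-fromℕ< 1+k<m) (cong suc (sym (Fin.toℕ-fromℕ< k<m)))))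
  where
  k<m : k ℕ.< m
  k<m = ℕ.<⇒≤ 1+k<m

entry-mono : ∀ {m} {M S : Matrix m} → IsSmithForm M S → ∀ {k l} → k ℕ.≤ l → entry S k ∣ entry S l
entry-mono {S = S} smith = ∣-chain (entry S) (entry-step smith)

conjugate : ∀ {m} {M S : Matrix m} → IsSmithForm M S →
  ∃[ W ] ∃[ Z ] S ≈ W · M · Z
conjugate {M = M} {S} smith =
  let U , V , unimodularU , unimodularV , M≈USV = IsSmithForm.factorization smith
      W , WU≈1 , _ = inverse U unimodularU
      Z , _ , VZ≈1 = inverse V unimodularV
  in W , Z , ≈-sym (≈-trans (·-congʳ Z (≈-trans (·-congˡ W M≈USV)
       (≈-trans (·-assoc W (U · S) V) (·-congʳ V (·-cancelˡ W U S WU≈1))))) (·-cancelʳ V Z S VZ≈1))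

-- A repeated column makes the minor 0. Otherwise column b is a multiple of the diagonal entry at J
-- b, and the product over distinct indices is a multiple of the product of the first j.
∏<-∣-minor : ∀ {m j} {M S : Matrix m} → IsSmithForm M S → ∀ (I J : Fin j → Fin m) → ∏< j (entry S) ∣ minor S I J
∏<-∣-minor {m} {j} {M} {S} smith I J with Fin.any? (λ b → Fin.any? λ c → ¬? (b Fin.≟ c) ×-dec (J b Fin.≟ J c))
... | yes (b , c , b≢c , Jb≡Jc) = subst (∏< j (entry S) ∣_)
  (sym (det-equalColumns (λ a b → S (I a) (J b)) b c b≢c λ a → cong (S (I a)) Jb≡Jc)) ∣0
... | no injective = ∣-trans
  (∏<-∣-∏ (entry S) (entry-mono smith) j (toℕ ∘ J) λ {b} {c} eq →
    decidable-stable (b Fin.≟ c) λ b≢c → injective (b , c , b≢c , Fin.toℕ-injective eq))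
  (∏-∣-det (entry S ∘ toℕ ∘ J) (λ a b → S (I a) (J b)) λ a b → entry-∣ (I a) (J b))
  where
  entry-∣ : ∀ i l → entry S (toℕ l) ∣ S i l
  entry-∣ i l with i Fin.≟ l
  ... | yes refl = ∣-reflexive (entry-toℕ S i)
  ... | no i≢l   = subst (entry S (toℕ l) ∣_) (sym (IsSmithForm.diagonal smith i l i≢l)) ∣0

leadingMinor : ∀ {m j} {M S : Matrix m} → IsSmithForm M S → (j≤m : j ℕ.≤ m) →
  minor S (λ a → inject≤ a j≤m) (λ b → inject≤ b j≤m) ≡ ∏< j (entry S)
leadingMinor {j = j} {S = S} smith j≤m = trans
  (det-diagonal (λ a b → S (inject≤ a j≤m) (inject≤ b j≤m)) λ a b a≢b →
    IsSmithForm.diagonal smith _ _ (a≢b ∘ Fin.inject≤-injective j≤m j≤m a b))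
  (trans (∏.sum-cong-≗ λ a → trans (sym (entry-toℕ S (inject≤ a j≤m))) (cong (entry S) (Fin.toℕ-inject≤ a j≤m)))
    (sym (∏<-∏ j (entry S))))

-- A common divisor of the minors survives multiplication by matrices on either side. M = U S V
-- gives one direction; S = W M Z, together with the leading minor of S, gives the other.
minors-content : ∀ {m j} {M S : Matrix m} → IsSmithForm M S → j ℕ.≤ m →
  IsContent {(Fin j → Fin m) × (Fin j → Fin m)} (∏< j (entry S)) (λ IJ → minor M (proj₁ IJ) (proj₂ IJ))
minors-content {m} {j} {M} {S} smith j≤m = record { divisor = div ; greatest = great }
  where
  P : ℤ
  P = ∏< j (entry S)
  div : ∀ IJ → P ∣ minor M (proj₁ IJ) (proj₂ IJ)
  div (I , J) = let U , V , _ , _ , M≈USV = IsSmithForm.factorization smith in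
    subst (P ∣_) (trans (ℤ.*-identityˡ (minor (U · S · V) I J)) (sym (minor-cong I J M≈USV)))
    (∣-minor-·ʳ 1ℤ (U · S) V (∣-minor-·ˡ 1ℤ U S λ I J → subst (P ∣_) (sym (ℤ.*-identityˡ (minor S I J))) (∏<-∣-minor smith I J)) I J)
  great : ∀ K z → (∀ IJ → K ∣ z * minor M (proj₁ IJ) (proj₂ IJ)) → K ∣ z * P
  great K z all = let W , Z , S≈ = conjugate smith
                      I = λ a → inject≤ a j≤m in
    subst (λ t → K ∣ z * t) (trans (sym (minor-cong I I S≈)) (leadingMinor smith j≤m))
      (∣-minor-·ʳ z (W · M) Z (∣-minor-·ˡ z W M λ I J → all (I , J)) I I)

-- Modulo S j j the matrix S′ = P S Q only involves the rows of Q above the j-th, so it kills a primitive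
-- vector y supported on the first j + 1 coordinates.
invariantFactor-∣ : ∀ {m} (A : Matrix m) {M S S′ : Matrix m} → IsSmithForm M S → IsSmithForm (A · M) S′ →
  ∀ j → S j j ∣ S′ j j
invariantFactor-∣ {suc m} A {M} {S} {S′} smith smith′ j =
  let U , V , _ , _ , M≈USV = IsSmithForm.factorization smith
      W , Z , S′≈ = conjugate smith′
  in conclude (W · (A · U)) (V · Z) (≈-trans S′≈ (≈-trans
       (·-congʳ Z (≈-trans (·-congˡ W (≈-trans (·-congˡ A M≈USV)
         (≈-trans (·-assoc A (U · S) V) (·-congʳ V (·-assoc A U S)))))
         (≈-trans (·-assoc W (A · U · S) V) (·-congʳ V (·-assoc W (A · U) S)))))
       (≈-sym (·-assoc (W · (A · U) · S) V Z))))
  where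
  diagonal-mono : ∀ {T N : Matrix (suc m)} → IsSmithForm N T → ∀ {a b} → toℕ a ℕ.≤ toℕ b → T a a ∣ T b b
  diagonal-mono {T} smithT {a} {b} a≤b = subst₂ _∣_ (entry-toℕ T a) (entry-toℕ T b) (entry-mono smithT a≤b)
  module _ (P Q : Matrix (suc m)) (S′≈PSQ : S′ ≈ P · S · Q) where
    row : ∀ i → Dec (toℕ i ℕ.< toℕ j) → Fin (suc m) → ℤ
    row i (yes _) = Q i
    row i (no _)  = identity i
    PS-∣ : ∀ a i → toℕ j ℕ.≤ toℕ i → S j j ∣ (P · S) a i
    PS-∣ a i j≤i = ∣-sum (λ k → P a k * S k i) λ k → ∣n⇒∣m*n (P a k) (column k)
      where
      column : ∀ k → S j j ∣ S k i
      column k with k Fin.≟ i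
      ... | yes refl = diagonal-mono smith j≤i
      ... | no k≢i   = subst (S j j ∣_) (sym (IsSmithForm.diagonal smith k i k≢i)) ∣0
    module _ (y : Fin (suc m) → ℤ) (row∙y≡0 : ∀ i → j ≢ i → row i (toℕ i ℕ.<? toℕ j) ∙ y ≡ 0ℤ) where
      above : ∀ i (d : Dec (toℕ i ℕ.< toℕ j)) → row i d ∙ y ≡ 0ℤ → toℕ i ℕ.< toℕ j → Q i ∙ y ≡ 0ℤ
      above i (yes _)   eq _   = eq
      above i (no i≮j) eq i<j = contradiction i<j i≮j
      below : ∀ i (d : Dec (toℕ i ℕ.< toℕ j)) → row i d ∙ y ≡ 0ℤ → toℕ j ℕ.< toℕ i → y i ≡ 0ℤ
      below i (yes i<j) eq j<i = contradiction i<j (ℕ.<-asym j<i)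
      below i (no _)    eq j<i = trans (sym (identity-∙ i y)) eq
      term-∣ : ∀ a i → S j j ∣ (P · S) a i * Q i ∙ y
      term-∣ a i = [ (λ j≤i → ∣m⇒∣m*n (Q i ∙ y) (PS-∣ a i j≤i))
                   , (λ i<j → subst (S j j ∣_) (sym (trans
                       (cong ((P · S) a i *_) (above i (toℕ i ℕ.<? toℕ j) (row∙y≡0 i λ { refl → ℕ.n≮n (toℕ j) i<j }) i<j))
                       (ℤ.*-zeroʳ ((P · S) a i)))) ∣0) ]′ (ℕ.≤-<-connex (toℕ j) (toℕ i))
      S∣S′y : ∀ a → S j j ∣ S′ a a * y a
      S∣S′y a = subst (S j j ∣_)
        (trans (∙-assoc ((P · S) a) Q y) (trans (sum-cong-≗ λ b → cong (_* y b) (sym (S′≈PSQ a b)))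
          (sum-only (λ b → S′ a b * y b) a λ b a≢b → trans (cong (_* y b) (IsSmithForm.diagonal smith′ a b a≢b)) (ℤ.*-zeroˡ (y b)))))
        (∣-sum (λ i → (P · S) a i * Q i ∙ y) (term-∣ a))
      S∣S′ⱼy : ∀ a → S j j ∣ S′ j j * y a
      S∣S′ⱼy a = [ (λ a≤j → ∣-trans (S∣S′y a) (*-monoˡ-∣ (y a) (diagonal-mono smith′ a≤j)))
                 , (λ j<a → subst (S j j ∣_) (sym (trans
                     (cong (S′ j j *_) (below a (toℕ a ℕ.<? toℕ j) (row∙y≡0 a λ { refl → ℕ.n≮n (toℕ j) j<a }) j<a))
                     (ℤ.*-zeroʳ (S′ j j)))) ∣0) ]′ (ℕ.≤-<-connex (toℕ a) (toℕ j))
    conclude : S j j ∣ S′ j j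
    conclude = let y , row∙y≡0 , prim = primitiveKernel m (λ k → row (punchIn j k) (toℕ (punchIn j k) ℕ.<? toℕ j)) in
      prim (S j j) (S′ j j) (S∣S′ⱼy y λ i j≢i →
        subst (λ i → row i (toℕ i ℕ.<? toℕ j) ∙ y ≡ 0ℤ) (Fin.punchIn-punchOut j≢i) (row∙y≡0 (punchOut j≢i)))

-- Powers of y modulo a monic polynomial

∣-*^-neg : ∀ {C} w x e → C ∣ w * x ^ᶻ e → C ∣ w * (- x) ^ᶻ e
∣-*^-neg {C} w x e C∣ = subst (C ∣_) (sym (trans
  (cong (λ y → w * y ^ᶻ e) (sym (ℤ.-1*i≡-i x))) (trans (cong (w *_) (^-distribʳ-* -1ℤ x e)) (lem w (-1ℤ ^ᶻ e) (x ^ᶻ e)))))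
  (∣n⇒∣m*n (-1ℤ ^ᶻ e) C∣)
  where
  lem : ∀ w s x → w * (s * x) ≡ s * (w * x)
  lem = solve-∀

∣-*^-cancelˡ : ∀ {C} w x y e → C ∣ w * (x + y) ^ᶻ e → C ∣ w * x ^ᶻ e → C ∣ w * y ^ᶻ e
∣-*^-cancelˡ {C} w x y e p q = subst (λ t → C ∣ w * t ^ᶻ e) (lem x y) (∣-*^-+ w (x + y) (- x) e p (∣-*^-neg w x e q))
  where
  lem : ∀ x y → x + y + - x ≡ y
  lem = solve-∀

1∣ : ∀ {x} → 1ℤ ∣ x
1∣ {x} = divides x (sym (ℤ.*-identityʳ x))

leastFailure : ∀ {P : ℕ → Set} → (∀ k → Dec (P k)) → ∀ n →
  (∀ k → k ℕ.≤ n → P k) ⊎ ∃[ t ] t ℕ.≤ n × (∀ k → k ℕ.< t → P k) × ¬ P t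
leastFailure P? zero with P? 0
... | yes p = inj₁ λ { _ z≤n → p }
... | no ¬p = inj₂ (0 , z≤n , (λ _ ()) , ¬p)
leastFailure P? (suc n) with leastFailure P? n
... | inj₂ (t , t≤n , below , ¬p) = inj₂ (t , ℕ.m≤n⇒m≤1+n t≤n , below , ¬p)
... | inj₁ all with P? (suc n)
...   | yes p = inj₁ λ k k≤1+n → [ (λ k<1+n → all k (ℕ.≤-pred k<1+n)) , (λ { refl → p }) ]′ (ℕ.m≤n⇒m<n∨m≡n k≤1+n)
...   | no ¬p = inj₂ (suc n , ℕ.≤-refl , (λ k k<1+n → all k (ℕ.≤-pred k<1+n)) , ¬p)

-- Multiplication by y in ℤ[y] / (y^(d+1) - Σ β k y^k), acting on the coefficients of 1, y, …, y^d.
module Companion (d : ℕ) (β : ℕ → ℤ) where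

  shift : (ℕ → ℤ) → ℕ → ℤ
  shift q zero    = 0ℤ
  shift q (suc k) = q k

  step : (ℕ → ℤ) → ℕ → ℤ
  step q k = shift q k + β k * q d

  steps : ℕ → (ℕ → ℤ) → ℕ → ℤ
  steps zero    q = q
  steps (suc n) q = step (steps n q)

  steps-+ : ∀ m n q → steps (m ℕ.+ n) q ≡ steps m (steps n q)
  steps-+ zero    n q = refl
  steps-+ (suc m) n q = cong step (steps-+ m n q)

  steps-cong : ∀ n {p q} → (∀ k → k ℕ.≤ d → p k ≡ q k) → ∀ k → k ℕ.≤ d → steps n p k ≡ steps n q k
  steps-cong zero    p≡q k k≤d = p≡q k k≤d
  steps-cong (suc n) {p} {q} p≡q k k≤d =
    cong₂ (λ x y → x + β k * y) (shift-cong k k≤d) (steps-cong n p≡q d ℕ.≤-refl)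
    where
    shift-cong : ∀ k → k ℕ.≤ d → shift (steps n p) k ≡ shift (steps n q) k
    shift-cong zero    _   = refl
    shift-cong (suc k) k<d = steps-cong n p≡q k (ℕ.<⇒≤ k<d)

  steps-linear : ∀ n a b p q k → steps n (λ k → a * p k + b * q k) k ≡ a * steps n p k + b * steps n q k
  steps-linear zero    a b p q k = refl
  steps-linear (suc n) a b p q k = trans
    (cong₂ (λ x y → x + β k * y) (shift-linear k) (steps-linear n a b p q d))
    (lem a b (shift (steps n p) k) (shift (steps n q) k) (β k) (steps n p d) (steps n q d))
    where
    lem : ∀ a b s t β x y → a * s + b * t + β * (a * x + b * y) ≡ a * (s + β * x) + b * (t + β * y)
    lem = solve-∀
    lem₀ : ∀ a b → 0ℤ ≡ a * 0ℤ + b * 0ℤ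
    lem₀ = solve-∀
    shift-linear : ∀ k → shift (steps n λ k → a * p k + b * q k) k ≡ a * shift (steps n p) k + b * shift (steps n q) k
    shift-linear zero    = lem₀ a b
    shift-linear (suc k) = steps-linear n a b p q k

  steps-scale : ∀ n a q k → steps n (λ k → a * q k) k ≡ a * steps n q k
  steps-scale zero    a q k = refl
  steps-scale (suc n) a q k = trans
    (cong₂ (λ x y → x + β k * y) (shift-scale k) (steps-scale n a q d))
    (lem a (shift (steps n q) k) (β k) (steps n q d))
    where
    lem : ∀ a s β x → a * s + β * (a * x) ≡ a * (s + β * x)
    lem = solve-∀
    shift-scale : ∀ k → shift (steps n λ k → a * q k) k ≡ a * shift (steps n q) k
    shift-scale zero    = sym (ℤ.*-zeroʳ a)
    shift-scale (suc k) = steps-scale n a q k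

  one : ℕ → ℤ
  one zero    = 1ℤ
  one (suc k) = 0ℤ

  power : ℕ → ℕ → ℤ
  power n = steps n one

  power-above : ∀ n k → n ℕ.< k → k ℕ.≤ d → power n k ≡ 0ℤ
  power-above zero    (suc k) _     _     = refl
  power-above (suc n) (suc k) (s≤s n<k) k<d = trans
    (cong₂ (λ x y → x + β (suc k) * y) (power-above n k n<k (ℕ.<⇒≤ k<d)) (power-above n d (ℕ.<-trans n<k k<d) ℕ.≤-refl))
    (trans (ℤ.+-identityˡ (β (suc k) * 0ℤ)) (ℤ.*-zeroʳ (β (suc k))))

  power-diagonal : ∀ n → n ℕ.≤ d → power n n ≡ 1ℤ
  power-diagonal zero    _   = refl
  power-diagonal (suc n) n<d = trans
    (cong₂ (λ x y → x + β (suc n) * y) (power-diagonal n (ℕ.<⇒≤ n<d)) (power-above n d n<d ℕ.≤-refl))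
    (trans (cong (1ℤ +_) (ℤ.*-zeroʳ (β (suc n)))) (ℤ.+-identityʳ 1ℤ))

  -- After substituting y = c^(1/e) z the defining polynomial of z still has algebraic integer coefficients, whose e-th
  -- powers are the γ k. That no prime divides all of them says that, for every p, the valuation of c^(1/e) is
  -- the smallest slope of the p-adic Newton polygon.
  module Weighted (e′ : ℕ) (c : ℤ) (γ : ℕ → ℤ) (c≢0 : c ≢ 0ℤ)
    (weights : ∀ k → k ℕ.≤ d → c ^ᶻ k * β k ^ᶻ suc e′ ≡ c ^ᶻ suc d * γ k)
    (primeFree : ∀ p → Prime p → ¬ (∀ k → k ℕ.≤ d → pos p ∣ γ k)) where

    e : ℕ
    e = suc e′

    shift-∣ : ∀ {A} q k → (∀ l → k ≡ suc l → A ∣ c ^ᶻ l * q l ^ᶻ e) → c * A ∣ c ^ᶻ k * shift q k ^ᶻ e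
    shift-∣ {A} q zero    A∣ = subst (c * A ∣_) (sym (lem (0ℤ ^ᶻ e′))) ∣0
      where
      lem : ∀ z → 1ℤ * (0ℤ * z) ≡ 0ℤ
      lem = solve-∀
    shift-∣ {A} q (suc k) A∣ = subst (c * A ∣_) (sym (ℤ.*-assoc c (c ^ᶻ k) (q k ^ᶻ e))) (*-monoʳ-∣ c (A∣ k refl))

    β-term : ∀ k → k ℕ.≤ d → ∀ x → c ^ᶻ k * (β k * x) ^ᶻ e ≡ c * (γ k * (c ^ᶻ d * x ^ᶻ e))
    β-term k k≤d x = begin
      c ^ᶻ k * (β k * x) ^ᶻ e               ≡⟨ cong (c ^ᶻ k *_) (^-distribʳ-* (β k) x e) ⟩
      c ^ᶻ k * (β k ^ᶻ e * x ^ᶻ e)          ≡⟨ ℤ.*-assoc (c ^ᶻ k) (β k ^ᶻ e) (x ^ᶻ e) ⟨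
      c ^ᶻ k * β k ^ᶻ e * x ^ᶻ e            ≡⟨ cong (_* x ^ᶻ e) (weights k k≤d) ⟩
      c * c ^ᶻ d * γ k * x ^ᶻ e             ≡⟨ lem c (c ^ᶻ d) (γ k) (x ^ᶻ e) ⟩
      c * (γ k * (c ^ᶻ d * x ^ᶻ e))         ∎
      where
      open ≡-Reasoning
      lem : ∀ c d γ x → c * d * γ * x ≡ c * (γ * (d * x))
      lem = solve-∀

    β-term-∣ : ∀ {A} k → k ℕ.≤ d → ∀ x → A ∣ γ k * (c ^ᶻ d * x ^ᶻ e) → c * A ∣ c ^ᶻ k * (β k * x) ^ᶻ e
    β-term-∣ {A} k k≤d x A∣ = subst (c * A ∣_) (sym (β-term k k≤d x)) (*-monoʳ-∣ c A∣)

    -- Write y = c^(1/e) z. The e-th power of the z^k-coefficient of yⁿ q is the right side;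
    -- multiplication by y is c^(1/e) times multiplication by z, which preserves integrality.
    level : ∀ n q k → k ℕ.≤ d → c ^ᶻ n ∣ c ^ᶻ k * steps n q k ^ᶻ e
    level zero    q k k≤d = 1∣
    level (suc n) q k k≤d = ∣-*^-+ (c ^ᶻ k) (shift (steps n q) k) (β k * steps n q d) e
      (shift-∣ (steps n q) k λ { l refl → level n q l (ℕ.<⇒≤ k≤d) })
      (β-term-∣ k k≤d (steps n q d) (∣n⇒∣m*n (γ k) (level n q d ℕ.≤-refl)))

    -- At n = et both sides of `level` become e-th powers once the weight c^k is enlarged to
    -- (c^d)^e. The factor c^d is the bounded loss.
    steps-∣ : ∀ t q k → k ℕ.≤ d → c ^ᶻ t ∣ c ^ᶻ d * steps (e ℕ.* t) q k
    steps-∣ t q k k≤d = ^-cancel-∣ e′ (subst₂ _∣_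
      (trans (cong (c ^ᶻ_) (ℕ.*-comm e t)) (sym (ℤ.^-*-assoc c t e)))
      (sym (^-distribʳ-* (c ^ᶻ d) (steps (e ℕ.* t) q k) e))
      (∣-trans (level (e ℕ.* t) q k k≤d) (*-monoˡ-∣ (steps (e ℕ.* t) q k ^ᶻ e) (∣-trans cᵏ∣cᵈ (∣m⇒∣m*n ((c ^ᶻ d) ^ᶻ e′) ∣-refl)))))
      where
      cᵏ∣cᵈ : c ^ᶻ k ∣ c ^ᶻ d
      cᵏ∣cᵈ = subst (λ n → c ^ᶻ k ∣ c ^ᶻ n) (ℕ.m+[n∸m]≡n k≤d)
        (subst (c ^ᶻ k ∣_) (sym (ℤ.^-distribˡ-+-* c k (d ℕ.∸ k))) (∣m⇒∣m*n (c ^ᶻ (d ℕ.∸ k)) ∣-refl))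

    module _ {p : ℕ} (pr : Prime p) (t : ℕ) (t≤d : t ℕ.≤ d)
      (γ-below : ∀ k → k ℕ.< t → pos p ∣ γ k) (γ-at : ¬ pos p ∣ γ t) where

      -- By `level` the k-th coefficient of zⁿ has integral e-th power; this says that p divides
      -- that e-th power. Here t is the least index with γ t prime to p.
      Strict : ℕ → ℕ → Set
      Strict n k = pos p * c ^ᶻ n ∣ c ^ᶻ k * power n k ^ᶻ e

      strict-suc : ∀ n {x} → c * (pos p * c ^ᶻ n) ∣ x → pos p * c ^ᶻ suc n ∣ x
      strict-suc n {x} = subst (_∣ x) (lem c (pos p) (c ^ᶻ n))
        where
        lem : ∀ c p x → c * (p * x) ≡ p * (c * x)
        lem = solve-∀

      strict-pred : ∀ n {x} → pos p * c ^ᶻ suc n ∣ x → c * (pos p * c ^ᶻ n) ∣ x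
      strict-pred n {x} = subst (_∣ x) (lem c (pos p) (c ^ᶻ n))
        where
        lem : ∀ c p x → p * (c * x) ≡ c * (p * x)
        lem = solve-∀

      -- Below t all γ k are divisible by p, so modulo p coefficients there only move upwards; the
      -- initial 1 has passed index k once k < n.
      strict-below : ∀ n k → k ℕ.< t → k ℕ.< n → Strict n k
      strict-below (suc n) k k<t k<1+n = strict-suc n (∣-*^-+ (c ^ᶻ k) (shift (power n) k) (β k * power n d) e
        (shift-∣ (power n) k λ { l refl → strict-below n l (ℕ.<⇒≤ k<t) (ℕ.≤-pred k<1+n) })
        (β-term-∣ k (ℕ.<⇒≤ (ℕ.<-≤-trans k<t t≤d)) (power n d) (*-mono-∣ (γ-below k k<t) (level n one d ℕ.≤-refl))))

      -- If z^(n+1) vanishes modulo p, so does zⁿ. At index t the shifted part vanishes by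
      -- `strict-below`, and since p does not divide γ t, the top coefficient of zⁿ vanishes. The
      -- feedback terms then vanish everywhere, and the other coefficients are read off one index
      -- higher.
      strict-pred-all : ∀ n → t ℕ.≤ n → (∀ k → k ℕ.≤ d → Strict (suc n) k) → ∀ k → k ℕ.≤ d → Strict n k
      strict-pred-all n t≤n strict k k≤d = [ lower , (λ { refl → top }) ]′ (ℕ.m≤n⇒m<n∨m≡n k≤d)
        where
        A : ℤ
        A = pos p * c ^ᶻ n
        γ-top : A ∣ γ t * (c ^ᶻ d * power n d ^ᶻ e)
        γ-top = ∣-cancelˡ-≢0 c c≢0 (subst (c * A ∣_) (β-term t t≤d (power n d))
          (∣-*^-cancelˡ (c ^ᶻ t) (shift (power n) t) (β t * power n d) e
            (strict-pred n (strict t t≤d))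
            (shift-∣ (power n) t λ { l refl → strict-below n l ℕ.≤-refl t≤n })))
        top : Strict n d
        top with level n one d ℕ.≤-refl
        ... | divides z eq = subst (A ∣_) (sym eq) (*-monoˡ-∣ (c ^ᶻ n)
          ([ (λ p∣γ → contradiction p∣γ γ-at) , (λ p∣z → p∣z) ]′ (prime-∣* pr (γ t) z
            (∣-cancelˡ-≢0 (c ^ᶻ n) (^-≢0 n c≢0) (subst₂ _∣_ (ℤ.*-comm (pos p) (c ^ᶻ n))
              (trans (cong (γ t *_) eq) (lem (γ t) z (c ^ᶻ n))) γ-top)))))
          where
          lem : ∀ g z x → g * (z * x) ≡ x * (g * z)
          lem = solve-∀
        lower : k ℕ.< d → Strict n k
        lower k<d = ∣-cancelˡ-≢0 c c≢0 (subst (c * A ∣_) (ℤ.*-assoc c (c ^ᶻ k) (power n k ^ᶻ e))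
          (∣-*^-cancelˡ (c ^ᶻ suc k) (β (suc k) * power n d) (power n k) e
            (subst (λ x → c * A ∣ c ^ᶻ suc k * x ^ᶻ e) (ℤ.+-comm (power n k) (β (suc k) * power n d))
              (strict-pred n (strict (suc k) k<d)))
            (β-term-∣ (suc k) k<d (power n d) (∣n⇒∣m*n (γ (suc k)) top))))

      -- Descend to n = t: there y^t is not yet reduced, its coefficient at t is 1, and p would
      -- divide 1.
      ¬strict : ∀ n → t ℕ.≤ n → ¬ (∀ k → k ℕ.≤ d → Strict n k)
      ¬strict n t≤n strict with t ℕ.≟ n
      ... | yes refl = prime∤1 pr (∣-cancelˡ-≢0 (c ^ᶻ t) (^-≢0 t c≢0) (subst₂ _∣_ (ℤ.*-comm (pos p) (c ^ᶻ t))
        (cong (c ^ᶻ t *_) (trans (cong (_^ᶻ e) (power-diagonal t t≤d)) (ℤ.^-zeroˡ e))) (strict t t≤d)))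
      ¬strict zero    z≤n strict | no 0≢0 = contradiction refl 0≢0
      ¬strict (suc n) t≤n strict | no t≢n = ¬strict n t≤n′ (strict-pred-all n t≤n′ strict)
        where
        t≤n′ : t ℕ.≤ n
        t≤n′ = ℕ.≤-pred (ℕ.≤∧≢⇒< t≤n t≢n)

    -- The quotients by cⁿ given by `level` have no common prime, by `¬strict` at the least index
    -- where γ is prime to p. That index is at most d, whence d ≤ n.
    power-primitive : ∀ n → d ℕ.≤ n → ∀ K z →
      (∀ k → k ℕ.≤ d → K ∣ z * (c ^ᶻ k * power n k ^ᶻ e)) → K ∣ z * c ^ᶻ n
    power-primitive n d≤n K z K∣ = primeFree⇒primitive w noPrime K (z * c ^ᶻ n) λ i →
      subst (K ∣_) (trans (cong (z *_) (_∣_.equality (divisible i))) (lem z (w i) (c ^ᶻ n))) (K∣ (toℕ i) (ℕ.≤-pred (Fin.toℕ<n i)))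
      where
      lem : ∀ z w c → z * (w * c) ≡ z * c * w
      lem = solve-∀
      divisible : ∀ (i : Fin (suc d)) → c ^ᶻ n ∣ c ^ᶻ toℕ i * power n (toℕ i) ^ᶻ e
      divisible i = level n one (toℕ i) (ℕ.≤-pred (Fin.toℕ<n i))
      w : Fin (suc d) → ℤ
      w i = quotient (divisible i)
      noPrime : ∀ p → Prime p → ¬ (∀ i → pos p ∣ w i)
      noPrime p pr p∣w = [ primeFree p pr , (λ { (t , t≤d , below , at) →
          ¬strict pr t t≤d below at n (ℕ.≤-trans t≤d d≤n) λ k k≤d →
            subst (λ k → pos p * c ^ᶻ n ∣ c ^ᶻ k * power n k ^ᶻ e) (Fin.toℕ-fromℕ< (s≤s k≤d))
              (subst (pos p * c ^ᶻ n ∣_) (sym (_∣_.equality (divisible (fromℕ< (s≤s k≤d))))) (*-monoˡ-∣ (c ^ᶻ n) (p∣w (fromℕ< (s≤s k≤d))))) })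
        ]′ (leastFailure (λ k → pos p ∣? γ k) d)

    -- The converse of `steps-∣`, by taking e-th powers, applying `power-primitive` and extracting
    -- the root. The factor δ is carried along because independence controls coefficients only up to
    -- it.
    power-∣ : ∀ t → d ℕ.≤ e ℕ.* t → ∀ K δ → (∀ k → k ℕ.≤ d → K ∣ power (e ℕ.* t) k * δ) → K ∣ δ * c ^ᶻ t
    power-∣ t d≤et K δ K∣ = ^-cancel-∣ e′ (subst (K ^ᶻ e ∣_)
      (trans (cong (δ ^ᶻ e *_) (trans (cong (c ^ᶻ_) (ℕ.*-comm e t)) (sym (ℤ.^-*-assoc c t e)))) (sym (^-distribʳ-* δ (c ^ᶻ t) e)))
      (power-primitive (e ℕ.* t) d≤et (K ^ᶻ e) (δ ^ᶻ e) λ k k≤d →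
        subst (K ^ᶻ e ∣_) (trans (cong (c ^ᶻ k *_) (^-distribʳ-* (power (e ℕ.* t) k) δ e)) (lem (c ^ᶻ k) (power (e ℕ.* t) k ^ᶻ e) (δ ^ᶻ e)))
          (∣n⇒∣m*n (c ^ᶻ k) (^-mono-∣ e (K∣ k k≤d)))))
      where
      lem : ∀ c q d → c * (q * d) ≡ d * (c * q)
      lem = solve-∀

-- Contents along a linear recurrence

infix 4 _~_

_~_ : ℤ → ℤ → Set
x ~ y = x ∣ y × y ∣ x

~-cancelˡ : ∀ c {x y} → c ≢ 0ℤ → c * x ~ c * y → x ~ y
~-cancelˡ c c≢0 (p , q) = ∣-cancelˡ-≢0 c c≢0 p , ∣-cancelˡ-≢0 c c≢0 q

-- The ratio β / α is rational and cleared of denominators, because the class has to be closed under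
-- rescaling by powers and under quotients.
Geometric : (ℕ → ℤ) → Set
Geometric g = (∀ n → g n ≢ 0ℤ) ×
  ∃[ T ] ∃[ n₀ ] ∃[ α ] ∃[ β ] α ≢ 0ℤ × (∀ n → n ℕ.≥ n₀ → α * g (n ℕ.+ suc T) ~ β * g n)

EventuallyZero : (ℕ → ℤ) → Set
EventuallyZero g = ∃[ n₀ ] ∀ n → n ℕ.≥ n₀ → g n ≡ 0ℤ

commonMultiple : ∀ n → ∃[ e ] ∀ i → suc i ℕ.≤ n → suc i ℕ.∣ suc e
commonMultiple n = ℕ.pred (n ℕ.!) , λ i i<n → subst (suc i ℕ.∣_) (sym (ℕ.suc-pred (n ℕ.!) {{n ℕ.!≢0}}))
  (ℕ.∣-trans (ℕ.m∣m*n (i ℕ.!)) (ℕ.m≤n⇒m!∣n! i<n))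

-- The k-th Newton slope is v(β k) / (d + 1 - k), so its minimum over k is v(c) / E, where E =
-- `suc e` is (d + 1)! and c is the gcd of the powers of β k with exponent E / (d + 1 - k).
weightsOf : ∀ d (β : ℕ → ℤ) → ∃[ e ] ∃[ c ] Σ[ γ ∈ (ℕ → ℤ) ]
  (c ≡ 0ℤ → ∀ k → k ℕ.≤ d → β k ≡ 0ℤ) ×
  (∀ k → k ℕ.≤ d → c ^ᶻ k * β k ^ᶻ suc e ≡ c ^ᶻ suc d * γ k) ×
  (c ≢ 0ℤ → ∀ p → Prime p → ¬ (∀ k → k ℕ.≤ d → pos p ∣ γ k))
weightsOf d β = e , c , γ , vanish , weights , primeFree
  where
  open ≡-Reasoning
  e : ℕ
  e = proj₁ (commonMultiple (suc d))
  codegree∣e : ∀ k → suc (d ℕ.∸ k) ℕ.∣ suc e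
  codegree∣e k = proj₂ (commonMultiple (suc d)) (d ℕ.∸ k) (s≤s (ℕ.m∸n≤m d k))
  f : ℕ → ℕ
  f k = ℕ._∣_.quotient (codegree∣e k)
  c : ℤ
  c = proj₁ (content {suc d} λ i → β (toℕ i) ^ᶻ f (toℕ i))
  isContent : IsContent c λ (i : Fin (suc d)) → β (toℕ i) ^ᶻ f (toℕ i)
  isContent = proj₂ (content {suc d} λ i → β (toℕ i) ^ᶻ f (toℕ i))
  w : Fin (suc d) → ℤ
  w i = quotient (divisor isContent i)
  -- w̄ is the cofactor of c in the power of β k, and γ k raises it to the codegree to reach the
  -- exponent `suc e`. A prime dividing all γ k would divide all w̄ k, against c being the content.
  w̄ γ : ℕ → ℤ
  w̄ = extendByZero w
  γ k = w̄ k ^ᶻ suc (d ℕ.∸ k)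
  β^f : ∀ k → k ℕ.≤ d → β k ^ᶻ f k ≡ w̄ k * c
  β^f k k≤d = subst (λ k → β k ^ᶻ f k ≡ w̄ k * c) (Fin.toℕ-fromℕ< (s≤s k≤d))
    (trans (_∣_.equality (divisor isContent (fromℕ< (s≤s k≤d)))) (cong (_* c) (sym (extendByZero-toℕ w (fromℕ< (s≤s k≤d))))))
  vanish : c ≡ 0ℤ → ∀ k → k ℕ.≤ d → β k ≡ 0ℤ
  vanish c≡0 k k≤d = ℤ.i^n≡0⇒i≡0 (β k) (f k) (trans (β^f k k≤d) (trans (cong (w̄ k *_) c≡0) (ℤ.*-zeroʳ (w̄ k))))
  weights : ∀ k → k ℕ.≤ d → c ^ᶻ k * β k ^ᶻ suc e ≡ c ^ᶻ suc d * γ k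
  weights k k≤d = begin
    c ^ᶻ k * β k ^ᶻ suc e                  ≡⟨ cong (λ n → c ^ᶻ k * β k ^ᶻ n) (ℕ._∣_.equality (codegree∣e k)) ⟩
    c ^ᶻ k * β k ^ᶻ (f k ℕ.* i)            ≡⟨ cong (c ^ᶻ k *_) (ℤ.^-*-assoc (β k) (f k) i) ⟨
    c ^ᶻ k * (β k ^ᶻ f k) ^ᶻ i             ≡⟨ cong (λ x → c ^ᶻ k * x ^ᶻ i) (β^f k k≤d) ⟩
    c ^ᶻ k * (w̄ k * c) ^ᶻ i               ≡⟨ cong (c ^ᶻ k *_) (^-distribʳ-* (w̄ k) c i) ⟩
    c ^ᶻ k * (γ k * c ^ᶻ i)                ≡⟨ lem (c ^ᶻ k) (γ k) (c ^ᶻ i) ⟩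
    c ^ᶻ k * c ^ᶻ i * γ k                  ≡⟨ cong (_* γ k) (ℤ.^-distribˡ-+-* c k i) ⟨
    c ^ᶻ (k ℕ.+ i) * γ k                   ≡⟨ cong (λ n → c ^ᶻ n * γ k) (trans (ℕ.+-suc k (d ℕ.∸ k)) (cong suc (ℕ.m+[n∸m]≡n k≤d))) ⟩
    c ^ᶻ suc d * γ k                       ∎
    where
    i : ℕ
    i = suc (d ℕ.∸ k)
    lem : ∀ x y z → x * (y * z) ≡ x * z * y
    lem = solve-∀
  primeFree : c ≢ 0ℤ → ∀ p → Prime p → ¬ (∀ k → k ℕ.≤ d → pos p ∣ γ k)
  primeFree c≢0 p pr p∣γ = prime∤1 pr (∣-cancelˡ-≢0 c c≢0 (subst₂ _∣_ (ℤ.*-comm (pos p) c) (ℤ.*-comm 1ℤ c)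
    (greatest isContent (pos p * c) 1ℤ λ i → subst (pos p * c ∣_)
      (trans (cong (_* c) (extendByZero-toℕ w i)) (trans (sym (_∣_.equality (divisor isContent i))) (sym (ℤ.*-identityˡ (β (toℕ i) ^ᶻ f (toℕ i))))))
      (*-monoˡ-∣ c (prime-∣^ pr (w̄ (toℕ i)) (suc (d ℕ.∸ toℕ i)) (p∣γ (toℕ i) (ℕ.≤-pred (Fin.toℕ<n i))))))))

congruentPair : ∀ {M} → M ≢ 0ℤ → ∀ n (y : ℕ → Fin n → ℤ) →
  ∃[ s ] ∃[ T ] ∀ i → M ∣ y (s ℕ.+ suc T) i - y s i
congruentPair {M} M≢0 n y with Fin.pigeonhole (ℕ.n<1+n (ℤ.∣ M ∣ ℕ.^ n)) residues
  where
  instance _ = ℤ.≢-nonZero M≢0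
  residues : Fin (suc (ℤ.∣ M ∣ ℕ.^ n)) → Fin (ℤ.∣ M ∣ ℕ.^ n)
  residues s = funToFin λ i → fromℕ< (n%ℕd<d (y (toℕ s) i) ℤ.∣ M ∣)
... | s , s′ , s<s′ , same with ℕ.m≤n⇒∃[o]m+o≡n s<s′
...   | T , s+T≡s′ = toℕ s , T , λ i → subst (λ t → M ∣ y t i - y (toℕ s) i) (sym (trans (ℕ.+-suc (toℕ s) T) s+T≡s′))
  (∣-trans m∣∣m∣ (divides (y (toℕ s′) i /ℕ ℤ.∣ M ∣ - y (toℕ s) i /ℕ ℤ.∣ M ∣)
    (trans (cong₂ _-_ (a≡a%ℕn+[a/ℕn]*n (y (toℕ s′) i) ℤ.∣ M ∣) (a≡a%ℕn+[a/ℕn]*n (y (toℕ s) i) ℤ.∣ M ∣))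
      (trans (cong (λ r → pos (y (toℕ s′) i %ℕ ℤ.∣ M ∣) + y (toℕ s′) i /ℕ ℤ.∣ M ∣ * pos ℤ.∣ M ∣ - (pos r + y (toℕ s) i /ℕ ℤ.∣ M ∣ * pos ℤ.∣ M ∣)) (residue≡ i))
        (lem (pos (y (toℕ s′) i %ℕ ℤ.∣ M ∣)) (y (toℕ s′) i /ℕ ℤ.∣ M ∣) (y (toℕ s) i /ℕ ℤ.∣ M ∣) (pos ℤ.∣ M ∣))))))
  where
  instance _ = ℤ.≢-nonZero M≢0
  lem : ∀ r a b m → r + a * m - (r + b * m) ≡ (a - b) * m
  lem = solve-∀
  residue : ∀ t i → Fin ℤ.∣ M ∣
  residue t i = fromℕ< (n%ℕd<d (y t i) ℤ.∣ M ∣)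
  residue≡ : ∀ i → y (toℕ s) i %ℕ ℤ.∣ M ∣ ≡ y (toℕ s′) i %ℕ ℤ.∣ M ∣
  residue≡ i = begin
    y (toℕ s) i %ℕ ℤ.∣ M ∣                             ≡⟨ Fin.toℕ-fromℕ< (n%ℕd<d (y (toℕ s) i) ℤ.∣ M ∣) ⟨
    toℕ (residue (toℕ s) i)                            ≡⟨ cong toℕ (Fin.finToFun-funToFin (residue (toℕ s)) i) ⟨
    toℕ (finToFun (funToFin (residue (toℕ s))) i)      ≡⟨ cong (λ x → toℕ (finToFun x i)) same ⟩
    toℕ (finToFun (funToFin (residue (toℕ s′))) i)     ≡⟨ cong toℕ (Fin.finToFun-funToFin (residue (toℕ s′)) i) ⟩
    toℕ (residue (toℕ s′) i)                           ≡⟨ Fin.toℕ-fromℕ< (n%ℕd<d (y (toℕ s′) i) ℤ.∣ M ∣) ⟩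
    y (toℕ s′) i %ℕ ℤ.∣ M ∣                            ∎
    where open ≡-Reasoning

-- Modulo a common multiple K of both contents, a congruence between the vectors suffices to compare
-- them.
content-~ : ∀ {I : Set} {K a b} (c : ℤ) {x y : I → ℤ} → IsContent a x → IsContent b y →
  (∀ i → K ∣ x i + - c * y i) → a ∣ K → c * b ∣ K → a ~ c * b
content-~ {K = K} {a} {b} c {x} {y} isA isB K∣ a∣K cb∣K =
  greatest isB a c (λ i → subst (a ∣_) (lem₁ (x i) c (y i)) (∣m∣n⇒∣m-n (divisor isA i) (∣-trans a∣K (K∣ i)))) ,
  subst (c * b ∣_) (ℤ.*-identityˡ a) (greatest isA (c * b) 1ℤ λ i →
    subst (c * b ∣_) (lem₂ (x i) c (y i)) (∣m∣n⇒∣m+n (∣-trans cb∣K (K∣ i)) (*-monoʳ-∣ c (divisor isB i))))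
  where
  lem₁ : ∀ x c y → x - (x + - c * y) ≡ c * y
  lem₁ = solve-∀
  lem₂ : ∀ x c y → x + - c * y + c * y ≡ 1ℤ * x
  lem₂ = solve-∀

-- A sparse presentation of a linear map: row x has P entries, at the positions `source x`. For
-- minors only the row selection varies and the column selection stays fixed.
module LinearRecursion {m P : ℕ} (u : ℕ → Fin m → ℤ) (coefficient : Fin m → Fin P → ℤ) (source : Fin m → Fin P → Fin m)
  (linear : ∀ n x → u (suc n) x ≡ coefficient x ∙ (u n ∘ source x))
  (g : ℕ → ℤ) (isContent : ∀ n → IsContent (g n) (u n)) where

  g-mono : ∀ {n n′} → n ℕ.≤ n′ → g n ∣ g n′
  g-mono = ∣-chain g λ n → subst (g n ∣_) (ℤ.*-identityˡ (g (suc n)))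
    (greatest (isContent (suc n)) (g n) 1ℤ λ x → subst (g n ∣_) (trans (sym (linear n x)) (sym (ℤ.*-identityˡ (u (suc n) x))))
      (∣-sum (λ p → coefficient x p * u n (source x p)) λ p → ∣n⇒∣m*n (coefficient x p) (divisor (isContent n) (source x p))))

  g-zero : ∀ n → (∀ x → u n x ≡ 0ℤ) → EventuallyZero g
  g-zero n u≡0 = n , λ n′ n≤n′ → 0∣⇒≡0 (subst (_∣ g n′) (content-0 (isContent n) u≡0) (g-mono n≤n′))

  advance : ∀ n N q → (∀ x → u n x ≡ ∑< N λ k → q k * u k x) → ∀ x → u (suc n) x ≡ ∑< N λ k → q k * u (suc k) x
  advance n N q u≡ x = begin
    u (suc n) x                                                   ≡⟨ linear n x ⟩
    coefficient x ∙ (u n ∘ source x)                              ≡⟨ sum-cong-≗ (λ p → cong (coefficient x p *_) (u≡ (source x p))) ⟩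
    coefficient x ∙ (λ p → ∑< N λ k → q k * u k (source x p))     ≡⟨ ∙-∑<ʳ N (coefficient x) q (λ k → u k ∘ source x) ⟩
    (∑< N λ k → q k * coefficient x ∙ (u k ∘ source x))           ≡⟨ ∑<-cong N (λ k _ → cong (q k *_) (sym (linear k x))) ⟩
    (∑< N λ k → q k * u (suc k) x)                                ∎
    where open ≡-Reasoning

  module Monic (d : ℕ) (β : ℕ → ℤ) (relation : ∀ x → u (suc d) x ≡ ∑< (suc d) λ k → β k * u k x)
    (δ : ℤ) (δ≢0 : δ ≢ 0ℤ)
    (independent : ∀ K (q : ℕ → ℤ) → (∀ x → K ∣ ∑< (suc d) λ k → q k * u k x) → ∀ k → k ℕ.≤ d → K ∣ q k * δ) where

    open Companion d β

    -- Sending y^k to u k for k ≤ d intertwines multiplication by y with the step of the orbit,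
    -- because both obey the same monic relation.
    expand : ∀ n x → u n x ≡ ∑< (suc d) λ k → power n k * u k x
    expand zero    x = sym (trans (∑<-head d (λ k → one k * u k x))
      (trans (cong₂ _+_ (ℤ.*-identityˡ (u 0 x)) (∑<-≡0 d (λ k → 0ℤ * u (suc k) x) λ k _ → ℤ.*-zeroˡ (u (suc k) x))) (ℤ.+-identityʳ (u 0 x))))
    expand (suc n) x = begin
      u (suc n) x
        ≡⟨ advance n (suc d) q (expand n) x ⟩
      (∑< d λ k → q k * u (suc k) x) + q d * u (suc d) x
        ≡⟨ cong₂ _+_ (trans (sym (ℤ.+-identityˡ (∑< d λ k → q k * u (suc k) x))) (cong (_+ (∑< d λ k → q k * u (suc k) x)) (sym (ℤ.*-zeroˡ (u 0 x)))))
             (cong (q d *_) (relation x)) ⟩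
      0ℤ * u 0 x + (∑< d λ k → q k * u (suc k) x) + q d * (∑< (suc d) λ k → β k * u k x)
        ≡⟨ cong (_+ q d * (∑< (suc d) λ k → β k * u k x)) (trans (sym (∑<-head d (λ k → shift q k * u k x))) (sym (ℤ.*-identityˡ (∑< (suc d) λ k → shift q k * u k x)))) ⟩
      1ℤ * (∑< (suc d) λ k → shift q k * u k x) + q d * (∑< (suc d) λ k → β k * u k x)
        ≡⟨ ∑<-linear (suc d) 1ℤ (q d) (λ k → shift q k * u k x) (λ k → β k * u k x) ⟨
      (∑< (suc d) λ k → 1ℤ * (shift q k * u k x) + q d * (β k * u k x))
        ≡⟨ ∑<-cong (suc d) (λ k _ → lem (shift q k) (u k x) (q d) (β k)) ⟩
      (∑< (suc d) λ k → step q k * u k x) ∎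
      where
      open ≡-Reasoning
      q : ℕ → ℤ
      q = power n
      lem : ∀ s u q b → 1ℤ * (s * u) + q * (b * u) ≡ (s + b * q) * u
      lem = solve-∀

    module _ (e′ : ℕ) (c : ℤ) (γ : ℕ → ℤ) (c≢0 : c ≢ 0ℤ)
      (weights : ∀ k → k ℕ.≤ d → c ^ᶻ k * β k ^ᶻ suc e′ ≡ c ^ᶻ suc d * γ k)
      (primeFree : ∀ p → Prime p → ¬ (∀ k → k ℕ.≤ d → pos p ∣ γ k)) where

      open Weighted e′ c γ c≢0 weights primeFree

      -- g grows along divisibility, so it may be bounded at e t: there it divides δ times every
      -- coefficient of y^(et), hence δ c^t.
      g-∣ : ∀ t → d ℕ.≤ t → ∀ n → n ℕ.≤ e ℕ.* t → g n ∣ δ * c ^ᶻ t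
      g-∣ t d≤t n n≤et = ∣-trans (g-mono n≤et) (power-∣ t (ℕ.≤-trans d≤t (ℕ.m≤n*m t e)) (g (e ℕ.* t)) δ
        (independent (g (e ℕ.* t)) (power (e ℕ.* t)) λ x → subst (g (e ℕ.* t) ∣_) (expand (e ℕ.* t) x) (divisor (isContent (e ℕ.* t)) x)))

      g≢0 : ∀ n → g n ≢ 0ℤ
      g≢0 n gn≡0 = *-≢0 δ≢0 (^-≢0 (n ℕ.+ d) c≢0) (0∣⇒≡0 (subst (_∣ δ * c ^ᶻ (n ℕ.+ d)) gn≡0
        (g-∣ (n ℕ.+ d) (ℕ.m≤n+m d n) n (ℕ.≤-trans (ℕ.m≤m+n n d) (ℕ.m≤n*m (n ℕ.+ d) e)))))

      -- One factor h pays for the denominator in `normalized`, the other for applying `steps-∣` to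
      -- the later multiplication. What remains, δ * c, completes the modulus `K`.
      h M : ℤ
      h = c ^ᶻ d
      M = h * h * (δ * c)

      h≢0 : h ≢ 0ℤ
      h≢0 = ^-≢0 d c≢0

      M≢0 : M ≢ 0ℤ
      M≢0 = *-≢0 (*-≢0 h≢0 h≢0) (*-≢0 δ≢0 c≢0)

      power-divisible : ∀ s (i : Fin (suc d)) → c ^ᶻ (d ℕ.+ s) ∣ h * power (e ℕ.* (d ℕ.+ s)) (toℕ i)
      power-divisible s i = steps-∣ (d ℕ.+ s) one (toℕ i) (ℕ.≤-pred (Fin.toℕ<n i))

      normalized : ℕ → Fin (suc d) → ℤ
      normalized s i = quotient (power-divisible s i)

      module _ (s T : ℕ) (congruent : ∀ i → M ∣ normalized (s ℕ.+ suc T) i - normalized s i) where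

        t₁ t₂ : ℕ
        t₁ = d ℕ.+ s
        t₂ = d ℕ.+ (s ℕ.+ suc T)

        t₂≡ : t₂ ≡ suc T ℕ.+ t₁
        t₂≡ = trans (sym (ℕ.+-assoc d s (suc T))) (ℕ.+-comm t₁ (suc T))

        cᵀ : ℤ
        cᵀ = c ^ᶻ suc T

        c^t₂ : c ^ᶻ t₂ ≡ cᵀ * c ^ᶻ t₁
        c^t₂ = trans (cong (c ^ᶻ_) t₂≡) (ℤ.^-distribˡ-+-* c (suc T) t₁)

        ρ : ℕ → ℤ
        ρ = extendByZero λ i → quotient (congruent i)

        difference : ∀ k → k ℕ.≤ d →
          h * power (e ℕ.* t₂) k + - cᵀ * h * power (e ℕ.* t₁) k ≡ c ^ᶻ t₂ * M * ρ k
        difference k k≤d = subst (λ k → h * power (e ℕ.* t₂) k + - cᵀ * h * power (e ℕ.* t₁) k ≡ c ^ᶻ t₂ * M * ρ k)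
          (Fin.toℕ-fromℕ< (s≤s k≤d)) (begin
            h * power (e ℕ.* t₂) (toℕ i) + - cᵀ * h * power (e ℕ.* t₁) (toℕ i)
              ≡⟨ cong (h * power (e ℕ.* t₂) (toℕ i) +_) (ℤ.*-assoc (- cᵀ) h (power (e ℕ.* t₁) (toℕ i))) ⟩
            h * power (e ℕ.* t₂) (toℕ i) + - cᵀ * (h * power (e ℕ.* t₁) (toℕ i))
              ≡⟨ cong₂ (λ x y → x + - cᵀ * y) (_∣_.equality (power-divisible (s ℕ.+ suc T) i)) (_∣_.equality (power-divisible s i)) ⟩
            y₂ * c ^ᶻ t₂ + - cᵀ * (y₁ * c ^ᶻ t₁)
              ≡⟨ cong (λ x → y₂ * x + - cᵀ * (y₁ * c ^ᶻ t₁)) c^t₂ ⟩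
            y₂ * (cᵀ * c ^ᶻ t₁) + - cᵀ * (y₁ * c ^ᶻ t₁)
              ≡⟨ lem y₂ cᵀ (c ^ᶻ t₁) y₁ ⟩
            cᵀ * c ^ᶻ t₁ * (y₂ - y₁)
              ≡⟨ cong₂ _*_ (sym c^t₂) (_∣_.equality (congruent i)) ⟩
            c ^ᶻ t₂ * (quotient (congruent i) * M)
              ≡⟨ lem′ (c ^ᶻ t₂) (quotient (congruent i)) M ⟩
            c ^ᶻ t₂ * M * quotient (congruent i)
              ≡⟨ cong (c ^ᶻ t₂ * M *_) (extendByZero-toℕ (λ i → quotient (congruent i)) i) ⟨
            c ^ᶻ t₂ * M * ρ (toℕ i) ∎)
          where
          open ≡-Reasoning
          i : Fin (suc d)
          i = fromℕ< (s≤s k≤d)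
          y₁ y₂ : ℤ
          y₁ = normalized s i
          y₂ = normalized (s ℕ.+ suc T) i
          lem : ∀ a b x y → a * (b * x) + - b * (y * x) ≡ b * x * (a - y)
          lem = solve-∀
          lem′ : ∀ x q m → x * (q * m) ≡ x * m * q
          lem′ = solve-∀

        module _ (t r : ℕ) (r<e : r ℕ.< e) where

          j n n⁺ : ℕ
          j  = e ℕ.* t ℕ.+ r
          n  = j ℕ.+ e ℕ.* t₁
          n⁺ = j ℕ.+ e ℕ.* t₂

          -- A common multiple of g n⁺ and cᵀ * g n; the extra factor c covers the remainder r < e.
          K : ℤ
          K = c ^ᶻ t₂ * c ^ᶻ t * (δ * c)

          steps-difference : ∀ k → k ℕ.≤ d → h * (power n⁺ k + - cᵀ * power n k) ≡ c ^ᶻ t₂ * M * steps j ρ k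
          steps-difference k k≤d = begin
            h * (power n⁺ k + - cᵀ * power n k)
              ≡⟨ cong₂ (λ p q → h * (p k + - cᵀ * q k)) (steps-+ j (e ℕ.* t₂) one) (steps-+ j (e ℕ.* t₁) one) ⟩
            h * (steps j (power (e ℕ.* t₂)) k + - cᵀ * steps j (power (e ℕ.* t₁)) k)
              ≡⟨ lem h (steps j (power (e ℕ.* t₂)) k) cᵀ (steps j (power (e ℕ.* t₁)) k) ⟩
            h * steps j (power (e ℕ.* t₂)) k + - cᵀ * h * steps j (power (e ℕ.* t₁)) k
              ≡⟨ steps-linear j h (- cᵀ * h) (power (e ℕ.* t₂)) (power (e ℕ.* t₁)) k ⟨
            steps j (λ k → h * power (e ℕ.* t₂) k + - cᵀ * h * power (e ℕ.* t₁) k) k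
              ≡⟨ steps-cong j difference k k≤d ⟩
            steps j (λ k → c ^ᶻ t₂ * M * ρ k) k
              ≡⟨ steps-scale j (c ^ᶻ t₂ * M) ρ k ⟩
            c ^ᶻ t₂ * M * steps j ρ k ∎
            where
            open ≡-Reasoning
            lem : ∀ h x c y → h * (x + - c * y) ≡ h * x + - c * h * y
            lem = solve-∀

          K∣power : ∀ k → k ℕ.≤ d → K ∣ power n⁺ k + - cᵀ * power n k
          K∣power k k≤d = ∣-cancelˡ-≢0 (h * h) (*-≢0 h≢0 h≢0) (subst₂ _∣_
            (lem₁ (c ^ᶻ t₂) h (δ * c) (c ^ᶻ t))
            (trans (lem₂ (c ^ᶻ t₂ * M) h (steps j ρ k)) (trans (cong (h *_) (sym (steps-difference k k≤d))) (sym (ℤ.*-assoc h h (power n⁺ k + - cᵀ * power n k)))))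
            (*-monoʳ-∣ (c ^ᶻ t₂ * M) (subst (λ q → c ^ᶻ t ∣ h * q k) (sym (steps-+ (e ℕ.* t) r ρ)) (steps-∣ t (steps r ρ) k k≤d))))
            where
            lem₁ : ∀ a h m b → a * (h * h * m) * b ≡ h * h * (a * b * m)
            lem₁ = solve-∀
            lem₂ : ∀ a h x → a * (h * x) ≡ h * (a * x)
            lem₂ = solve-∀

          K∣u : ∀ x → K ∣ u n⁺ x + - cᵀ * u n x
          K∣u x = subst (K ∣_) (begin
            (∑< (suc d) λ k → 1ℤ * (power n⁺ k * u k x) + - cᵀ * (power n k * u k x))
              ≡⟨ ∑<-linear (suc d) 1ℤ (- cᵀ) (λ k → power n⁺ k * u k x) (λ k → power n k * u k x) ⟩
            1ℤ * (∑< (suc d) λ k → power n⁺ k * u k x) + - cᵀ * (∑< (suc d) λ k → power n k * u k x)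
              ≡⟨ cong₂ (λ a b → a + - cᵀ * b) (trans (ℤ.*-identityˡ (∑< (suc d) λ k → power n⁺ k * u k x)) (sym (expand n⁺ x))) (sym (expand n x)) ⟩
            u n⁺ x + - cᵀ * u n x ∎)
            (∣-∑< (suc d) (λ k → 1ℤ * (power n⁺ k * u k x) + - cᵀ * (power n k * u k x)) λ k k<1+d →
              subst (K ∣_) (lem (power n⁺ k) cᵀ (power n k) (u k x)) (∣m⇒∣m*n (u k x) (K∣power k (ℕ.≤-pred k<1+d))))
            where
            open ≡-Reasoning
            lem : ∀ p c q u → (p + - c * q) * u ≡ 1ℤ * (p * u) + - c * (q * u)
            lem = solve-∀

          bound : ∀ t′ → j ℕ.+ e ℕ.* t′ ℕ.≤ e ℕ.* suc (t′ ℕ.+ t)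
          bound t′ = begin
            e ℕ.* t ℕ.+ r ℕ.+ e ℕ.* t′       ≤⟨ ℕ.+-monoˡ-≤ (e ℕ.* t′) (ℕ.+-monoʳ-≤ (e ℕ.* t) (ℕ.<⇒≤ r<e)) ⟩
            e ℕ.* t ℕ.+ e ℕ.+ e ℕ.* t′       ≡⟨ cong (ℕ._+ e ℕ.* t′) (trans (ℕ.+-comm (e ℕ.* t) e) (sym (ℕ.*-suc e t))) ⟩
            e ℕ.* suc t ℕ.+ e ℕ.* t′         ≡⟨ ℕ.*-distribˡ-+ e (suc t) t′ ⟨
            e ℕ.* (suc t ℕ.+ t′)             ≡⟨ cong (λ x → e ℕ.* suc x) (ℕ.+-comm t t′) ⟩
            e ℕ.* suc (t′ ℕ.+ t)             ∎
            where open ℕ.≤-Reasoning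

          c^suc : ∀ t′ → δ * c ^ᶻ suc (t′ ℕ.+ t) ≡ c ^ᶻ t′ * c ^ᶻ t * (δ * c)
          c^suc t′ = trans (cong (λ x → δ * (c * x)) (ℤ.^-distribˡ-+-* c t′ t)) (lem δ c (c ^ᶻ t′ * c ^ᶻ t))
            where
            lem : ∀ d c x → d * (c * x) ≡ x * (d * c)
            lem = solve-∀

          g⁺∣K : g n⁺ ∣ K
          g⁺∣K = subst (g n⁺ ∣_) (c^suc t₂)
            (g-∣ (suc (t₂ ℕ.+ t)) (ℕ.m≤n⇒m≤1+n (ℕ.≤-trans (ℕ.m≤m+n d (s ℕ.+ suc T)) (ℕ.m≤m+n t₂ t))) n⁺ (bound t₂))

          g∣K : cᵀ * g n ∣ K
          g∣K = subst (cᵀ * g n ∣_) (trans (cong (cᵀ *_) (c^suc t₁))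
            (trans (lem cᵀ (c ^ᶻ t₁) (c ^ᶻ t) (δ * c)) (cong (λ x → x * c ^ᶻ t * (δ * c)) (sym c^t₂))))
            (*-monoʳ-∣ cᵀ (g-∣ (suc (t₁ ℕ.+ t)) (ℕ.m≤n⇒m≤1+n (ℕ.≤-trans (ℕ.m≤m+n d s) (ℕ.m≤m+n t₁ t))) n (bound t₁)))
            where
            lem : ∀ T x y z → T * (x * y * z) ≡ T * x * y * z
            lem = solve-∀

          g-~ : g n⁺ ~ cᵀ * g n
          g-~ = content-~ {K = K} cᵀ (isContent n⁺) (isContent n) K∣u g⁺∣K g∣K

        -- Dividing n - e t₁ by e with remainder brings every such n to the form treated in `g-~`.
        g-geometric : ∀ n → n ℕ.≥ e ℕ.* t₁ → 1ℤ * g (n ℕ.+ e ℕ.* suc T) ~ cᵀ * g n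
        g-geometric n n≥ = subst₂ (λ n⁺ n → 1ℤ * g n⁺ ~ cᵀ * g n) n⁺-split n-split
          (subst (_~ cᵀ * g (e ℕ.* (l ℕ./ e) ℕ.+ l ℕ.% e ℕ.+ e ℕ.* t₁)) (sym (ℤ.*-identityˡ (g (e ℕ.* (l ℕ./ e) ℕ.+ l ℕ.% e ℕ.+ e ℕ.* t₂))))
            (g-~ (l ℕ./ e) (l ℕ.% e) (ℕ.m%n<n l e)))
          where
          l : ℕ
          l = n ℕ.∸ e ℕ.* t₁
          l≡ : e ℕ.* (l ℕ./ e) ℕ.+ l ℕ.% e ≡ l
          l≡ = trans (ℕ.+-comm (e ℕ.* (l ℕ./ e)) (l ℕ.% e)) (trans (cong (l ℕ.% e ℕ.+_) (ℕ.*-comm e (l ℕ./ e))) (sym (ℕ.m≡m%n+[m/n]*n l e)))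
          n-split : e ℕ.* (l ℕ./ e) ℕ.+ l ℕ.% e ℕ.+ e ℕ.* t₁ ≡ n
          n-split = trans (cong (ℕ._+ e ℕ.* t₁) l≡) (ℕ.m∸n+n≡m n≥)
          n⁺-split : e ℕ.* (l ℕ./ e) ℕ.+ l ℕ.% e ℕ.+ e ℕ.* t₂ ≡ n ℕ.+ e ℕ.* suc T
          n⁺-split = begin
            e ℕ.* (l ℕ./ e) ℕ.+ l ℕ.% e ℕ.+ e ℕ.* t₂                       ≡⟨ cong₂ ℕ._+_ l≡ (trans (cong (e ℕ.*_) (sym (ℕ.+-assoc d s (suc T)))) (ℕ.*-distribˡ-+ e t₁ (suc T))) ⟩
            l ℕ.+ (e ℕ.* t₁ ℕ.+ e ℕ.* suc T)                               ≡⟨ ℕ.+-assoc l (e ℕ.* t₁) (e ℕ.* suc T) ⟨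
            l ℕ.+ e ℕ.* t₁ ℕ.+ e ℕ.* suc T                                 ≡⟨ cong (ℕ._+ e ℕ.* suc T) (ℕ.m∸n+n≡m n≥) ⟩
            n ℕ.+ e ℕ.* suc T                                              ∎
            where open ≡-Reasoning

      geometric : Geometric g
      geometric = let s , T , congruent = congruentPair M≢0 (suc d) normalized in
        -- The period e * suc T is recorded through its predecessor.
        g≢0 , T ℕ.+ e′ ℕ.* suc T , e ℕ.* (d ℕ.+ s) , 1ℤ , c ^ᶻ suc T , (λ ()) , g-geometric s T congruent

    dichotomy : EventuallyZero g ⊎ Geometric g
    dichotomy = let e , c , γ , vanish , weights , primeFree = weightsOf d β in
      decide e c γ vanish weights primeFree (c ℤ.≟ 0ℤ)
      where
      decide : ∀ e c γ → (c ≡ 0ℤ → ∀ k → k ℕ.≤ d → β k ≡ 0ℤ) →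
        (∀ k → k ℕ.≤ d → c ^ᶻ k * β k ^ᶻ suc e ≡ c ^ᶻ suc d * γ k) →
        (c ≢ 0ℤ → ∀ p → Prime p → ¬ (∀ k → k ℕ.≤ d → pos p ∣ γ k)) → Dec (c ≡ 0ℤ) → EventuallyZero g ⊎ Geometric g
      decide e c γ vanish weights primeFree (no c≢0)  = inj₂ (geometric e c γ c≢0 weights (primeFree c≢0))
      decide e c γ vanish weights primeFree (yes c≡0) = inj₁ (g-zero (suc d) λ x → trans (relation x)
        (∑<-≡0 (suc d) (λ k → β k * u k x) λ k k<1+d → trans (cong (_* u k x) (vanish c≡0 k (ℕ.≤-pred k<1+d))) (ℤ.*-zeroˡ (u k x))))

-- If a u(d+1) = Σ b k u(k), then ũ n = aⁿ u n satisfies a monic recurrence.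
module _ {m P : ℕ} (u : ℕ → Fin m → ℤ) (coefficient : Fin m → Fin P → ℤ) (source : Fin m → Fin P → Fin m)
  (linear : ∀ n x → u (suc n) x ≡ coefficient x ∙ (u n ∘ source x))
  (g : ℕ → ℤ) (isContent : ∀ n → IsContent (g n) (u n)) where

  module _ (d : ℕ) (ind : Independent u (suc d)) (a : ℤ) (b : ℕ → ℤ) (a≢0 : a ≢ 0ℤ)
    (relation : ∀ x → a * u (suc d) x ≡ ∑< (suc d) λ k → b k * u k x) where

    open ≡-Reasoning

    ũ : ℕ → Fin m → ℤ
    ũ n x = a ^ᶻ n * u n x

    -- Multiplying the relation by a^d and giving a^k to u k leaves a^(d-k) on b k.
    g̃ β̃ : ℕ → ℤ
    g̃ n = a ^ᶻ n * g n
    β̃ k = a ^ᶻ (d ℕ.∸ k) * b k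

    aᵈ : ∀ k → k ℕ.≤ d → a ^ᶻ d ≡ a ^ᶻ k * a ^ᶻ (d ℕ.∸ k)
    aᵈ k k≤d = trans (cong (a ^ᶻ_) (sym (ℕ.m+[n∸m]≡n k≤d))) (ℤ.^-distribˡ-+-* a k (d ℕ.∸ k))

    linear̃ : ∀ n x → ũ (suc n) x ≡ (λ p → a * coefficient x p) ∙ (ũ n ∘ source x)
    linear̃ n x = begin
      a ^ᶻ suc n * u (suc n) x                          ≡⟨ cong (a ^ᶻ suc n *_) (linear n x) ⟩
      a ^ᶻ suc n * coefficient x ∙ (u n ∘ source x)     ≡⟨ *-distribˡ-sum (a ^ᶻ suc n) (λ p → coefficient x p * u n (source x p)) ⟩
      sum (λ p → a * a ^ᶻ n * (coefficient x p * u n (source x p)))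
        ≡⟨ sum-cong-≗ (λ p → lem a (a ^ᶻ n) (coefficient x p) (u n (source x p))) ⟩
      (λ p → a * coefficient x p) ∙ (ũ n ∘ source x)    ∎
      where
      lem : ∀ a b c u → a * b * (c * u) ≡ a * c * (b * u)
      lem = solve-∀

    isContent̃ : ∀ n → IsContent (g̃ n) (ũ n)
    isContent̃ n = record
      { divisor  = λ x → *-monoʳ-∣ (a ^ᶻ n) (divisor (isContent n) x)
      ; greatest = λ K z K∣ → subst (K ∣_) (ℤ.*-assoc z (a ^ᶻ n) (g n)) (greatest (isContent n) K (z * a ^ᶻ n) λ x →
          subst (K ∣_) (sym (ℤ.*-assoc z (a ^ᶻ n) (u n x))) (K∣ x))
      }

    relatioñ : ∀ x → ũ (suc d) x ≡ ∑< (suc d) λ k → β̃ k * ũ k x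
    relatioñ x = begin
      a * a ^ᶻ d * u (suc d) x                             ≡⟨ lem₁ a (a ^ᶻ d) (u (suc d) x) ⟩
      a ^ᶻ d * (a * u (suc d) x) + 0ℤ * 0ℤ                 ≡⟨ cong (λ t → a ^ᶻ d * t + 0ℤ * 0ℤ) (relation x) ⟩
      a ^ᶻ d * ∑b + 0ℤ * 0ℤ                                ≡⟨ cong (λ t → a ^ᶻ d * ∑b + 0ℤ * t) (∑<-≡0 (suc d) (λ _ → 0ℤ) λ _ _ → refl) ⟨
      a ^ᶻ d * ∑b + 0ℤ * ∑< (suc d) (λ _ → 0ℤ)             ≡⟨ ∑<-linear (suc d) (a ^ᶻ d) 0ℤ (λ k → b k * u k x) (λ _ → 0ℤ) ⟨
      (∑< (suc d) λ k → a ^ᶻ d * (b k * u k x) + 0ℤ * 0ℤ)  ≡⟨ ∑<-cong (suc d) (λ k k<1+d → trans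
                                                                (cong (λ t → t * (b k * u k x) + 0ℤ * 0ℤ) (aᵈ k (ℕ.≤-pred k<1+d)))
                                                                (lem₂ (a ^ᶻ k) (a ^ᶻ (d ℕ.∸ k)) (b k) (u k x))) ⟩
      (∑< (suc d) λ k → β̃ k * ũ k x)                       ∎
      where
      ∑b : ℤ
      ∑b = ∑< (suc d) λ k → b k * u k x
      lem₁ : ∀ a e u → a * e * u ≡ e * (a * u) + 0ℤ * 0ℤ
      lem₁ = solve-∀
      lem₂ : ∀ p q b u → p * q * (b * u) + 0ℤ * 0ℤ ≡ q * b * (p * u)
      lem₂ = solve-∀

    -- The coefficient of ũ k bounds q k only up to a^k, so the denominator grows to scale times
    -- a^d, uniformly in k.
    independent̃ : ∀ K (q : ℕ → ℤ) → (∀ x → K ∣ ∑< (suc d) λ k → q k * ũ k x) → ∀ k → k ℕ.≤ d → K ∣ q k * (scale ind * a ^ᶻ d)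
    independent̃ K q K∣ k k≤d = subst (K ∣_)
      (trans (lem (q k) (a ^ᶻ k) (scale ind) (a ^ᶻ (d ℕ.∸ k))) (cong (λ t → q k * (scale ind * t)) (sym (aᵈ k k≤d))))
      (∣m⇒∣m*n (a ^ᶻ (d ℕ.∸ k)) (∣-coefficients ind K (λ k → q k * a ^ᶻ k)
        (λ x → subst (K ∣_) (∑<-cong (suc d) λ k _ → sym (ℤ.*-assoc (q k) (a ^ᶻ k) (u k x))) (K∣ x)) k (s≤s k≤d)))
      where
      lem : ∀ q x s y → q * x * s * y ≡ q * (s * (x * y))
      lem = solve-∀

    unscale : EventuallyZero g̃ ⊎ Geometric g̃ → EventuallyZero g ⊎ Geometric g
    unscale (inj₁ (n₀ , g̃≡0)) = inj₁ (n₀ , λ n n≥n₀ →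
      *-cancelˡ-≢0 (a ^ᶻ n) (^-≢0 n a≢0) (trans (g̃≡0 n n≥n₀) (sym (ℤ.*-zeroʳ (a ^ᶻ n)))))
    unscale (inj₂ (g̃≢0 , T , n₀ , α , β , α≢0 , g̃~)) = inj₂
      ( (λ n gn≡0 → g̃≢0 n (trans (cong (a ^ᶻ n *_) gn≡0) (ℤ.*-zeroʳ (a ^ᶻ n))))
      , T , n₀ , α * a ^ᶻ suc T , β , *-≢0 α≢0 (^-≢0 (suc T) a≢0)
      , λ n n≥n₀ → ~-cancelˡ (a ^ᶻ n) (^-≢0 n a≢0) (subst₂ _~_
          (trans (cong (λ t → α * (t * g (n ℕ.+ suc T))) (ℤ.^-distribˡ-+-* a n (suc T))) (lem₁ α (a ^ᶻ n) (a ^ᶻ suc T) (g (n ℕ.+ suc T))))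
          (lem₂ β (a ^ᶻ n) (g n)) (g̃~ n n≥n₀)) )
      where
      lem₁ : ∀ α x y g → α * (x * y * g) ≡ x * (α * y * g)
      lem₁ = solve-∀
      lem₂ : ∀ β x g → β * (x * g) ≡ x * (β * g)
      lem₂ = solve-∀

    dichotomyFromRelation : EventuallyZero g ⊎ Geometric g
    dichotomyFromRelation = unscale (LinearRecursion.Monic.dichotomy ũ (λ x p → a * coefficient x p) source linear̃ g̃ isContent̃
      d β̃ relatioñ (scale ind * a ^ᶻ d) (*-≢0 (scale≢0 ind) (^-≢0 d a≢0)) independent̃)

  content-dichotomy : EventuallyZero g ⊎ Geometric g
  content-dichotomy = let n , ind , a , b , a≢0 , relation = firstRelation u in split n ind a b a≢0 relation
    where
    split : ∀ n → Independent u n → ∀ a (b : ℕ → ℤ) → a ≢ 0ℤ → (∀ x → a * u n x ≡ ∑< n λ k → b k * u k x) → EventuallyZero g ⊎ Geometric g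
    split zero    ind a b a≢0 relation = inj₁ (LinearRecursion.g-zero u coefficient source linear g isContent 0
      λ x → *-cancelˡ-≢0 a a≢0 (trans (relation x) (sym (ℤ.*-zeroʳ a))))
    split (suc d) ind a b a≢0 relation = dichotomyFromRelation d ind a b a≢0 relation

-- Determinantal divisors of the powers of A

module _ {m : ℕ} (A : Matrix m) (S : ℕ → Matrix m) (smith : ∀ n → IsSmithForm (A ^ n) (S n)) where

  determinantalDivisor : ℕ → ℕ → ℤ
  determinantalDivisor j n = ∏< j (entry (S n))

  module _ (j : ℕ) (j≤m : j ℕ.≤ m) where

    rows columns : Fin (m ℕ.^ j ℕ.* m ℕ.^ j) → Fin j → Fin m
    rows    x = finToFun (Fin.quotient {m ℕ.^ j} (m ℕ.^ j) x)
    columns x = finToFun (Fin.remainder {m ℕ.^ j} (m ℕ.^ j) x)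

    index : (Fin j → Fin m) → (Fin j → Fin m) → Fin (m ℕ.^ j ℕ.* m ℕ.^ j)
    index I J = combine (funToFin I) (funToFin J)

    rows-index : ∀ I J a → rows (index I J) a ≡ I a
    rows-index I J a = trans (cong (λ xy → finToFun {m} {j} (proj₁ xy) a) (Fin.remQuot-combine {m ℕ.^ j} (funToFin I) (funToFin J)))
      (Fin.finToFun-funToFin I a)

    columns-index : ∀ I J b → columns (index I J) b ≡ J b
    columns-index I J b = trans (cong (λ xy → finToFun {m} {j} (proj₂ xy) b) (Fin.remQuot-combine {m ℕ.^ j} (funToFin I) (funToFin J)))
      (Fin.finToFun-funToFin J b)

    minors : ℕ → Fin (m ℕ.^ j ℕ.* m ℕ.^ j) → ℤ
    minors n x = minor (A ^ n) (rows x) (columns x)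

    minors-linear : ∀ n x → minors (suc n) x ≡
      (λ K → ∏ λ a → A (rows x a) (finToFun K a)) ∙ (λ K → minors n (index (finToFun K) (columns x)))
    minors-linear n x = trans (minor-· A (A ^ n) (rows x) (columns x)) (sum-cong-≗ λ K →
      cong ((∏ λ a → A (rows x a) (finToFun K a)) *_) (minor-congᵢ (A ^ n)
        (λ a → sym (rows-index (finToFun K) (columns x) a)) (λ b → sym (columns-index (finToFun K) (columns x) b))))

    minors-isContent : ∀ n → IsContent (determinantalDivisor j n) (minors n)
    minors-isContent n = record
      { divisor  = λ x → divisor isC (rows x , columns x)
      ; greatest = λ K z K∣ → greatest isC K z λ IJ → subst (λ t → K ∣ z * t)
          (minor-congᵢ (A ^ n) (rows-index (proj₁ IJ) (proj₂ IJ)) (columns-index (proj₁ IJ) (proj₂ IJ))) (K∣ (index (proj₁ IJ) (proj₂ IJ)))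
      }
      where
      isC : IsContent (determinantalDivisor j n) λ IJ → minor (A ^ n) (proj₁ IJ) (proj₂ IJ)
      isC = minors-content (smith n) j≤m

    determinantalDivisor-dichotomy : EventuallyZero (determinantalDivisor j) ⊎ Geometric (determinantalDivisor j)
    determinantalDivisor-dichotomy = content-dichotomy minors
      (λ x K → ∏ λ a → A (rows x a) (finToFun K a)) (λ x K → index (finToFun K) (columns x))
      minors-linear (determinantalDivisor j) minors-isContent

-- Periodicity of the ratios

~-trans : ∀ {x y z} → x ~ y → y ~ z → x ~ z
~-trans (p , q) (r , s) = ∣-trans p r , ∣-trans s q

~-*ˡ : ∀ c {x y} → x ~ y → c * x ~ c * y
~-*ˡ c (p , q) = *-monoʳ-∣ c p , *-monoʳ-∣ c q

~-nonnegative : ∀ {a b x y} → 0ℤ ℤ.≤ x → 0ℤ ℤ.≤ y → a * x ~ b * y → pos ℤ.∣ a ∣ * x ≡ pos ℤ.∣ b ∣ * y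
~-nonnegative {a} {b} {x} {y} 0≤x 0≤y (p , q) = begin
  pos ℤ.∣ a ∣ * x             ≡⟨ cong (pos ℤ.∣ a ∣ *_) (ℤ.0≤i⇒+∣i∣≡i 0≤x) ⟨
  pos ℤ.∣ a ∣ * pos ℤ.∣ x ∣   ≡⟨ ℤ.pos-* ℤ.∣ a ∣ ℤ.∣ x ∣ ⟨
  pos (ℤ.∣ a ∣ ℕ.* ℤ.∣ x ∣)   ≡⟨ cong pos (ℤ.abs-* a x) ⟨
  pos ℤ.∣ a * x ∣             ≡⟨ cong pos (ℕ.∣-antisym (∣⇒∣ᵤ p) (∣⇒∣ᵤ q)) ⟩
  pos ℤ.∣ b * y ∣             ≡⟨ cong pos (ℤ.abs-* b y) ⟩
  pos (ℤ.∣ b ∣ ℕ.* ℤ.∣ y ∣)   ≡⟨ ℤ.pos-* ℤ.∣ b ∣ ℤ.∣ y ∣ ⟩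
  pos ℤ.∣ b ∣ * pos ℤ.∣ y ∣   ≡⟨ cong (pos ℤ.∣ b ∣ *_) (ℤ.0≤i⇒+∣i∣≡i 0≤y) ⟩
  pos ℤ.∣ b ∣ * y             ∎
  where open ≡-Reasoning

geometric-iterate : ∀ {g : ℕ → ℤ} {T n₀ α β} → (∀ n → n ℕ.≥ n₀ → α * g (n ℕ.+ T) ~ β * g n) →
  ∀ k n → n ℕ.≥ n₀ → α ^ᶻ k * g (n ℕ.+ k ℕ.* T) ~ β ^ᶻ k * g n
geometric-iterate {g} {T} {n₀} {α} {β} g~ zero    n n≥n₀ =
  subst (λ n′ → 1ℤ * g n′ ~ 1ℤ * g n) (sym (ℕ.+-identityʳ n)) (∣-refl , ∣-refl)
geometric-iterate {g} {T} {n₀} {α} {β} g~ (suc k) n n≥n₀ = ~-trans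
  (subst₂ _~_ (trans (sym (ℤ.*-assoc α (α ^ᶻ k) (g (n ℕ.+ T ℕ.+ k ℕ.* T)))) (cong (λ n′ → α * α ^ᶻ k * g n′) (ℕ.+-assoc n T (k ℕ.* T))))
    (lem₁ α (β ^ᶻ k) (g (n ℕ.+ T)))
    (~-*ˡ α (geometric-iterate {g} {T} {n₀} {α} {β} g~ k (n ℕ.+ T) (ℕ.m≤n⇒m≤n+o T n≥n₀))))
  (subst (β ^ᶻ k * (α * g (n ℕ.+ T)) ~_) (lem₂ β (β ^ᶻ k) (g n)) (~-*ˡ (β ^ᶻ k) (g~ n n≥n₀)))
  where
  lem₁ : ∀ α b g → α * (b * g) ≡ b * (α * g)
  lem₁ = solve-∀
  lem₂ : ∀ β b g → b * (β * g) ≡ β * b * g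
  lem₂ = solve-∀

-- Iterating both relations to the common shift (T + 1)(T′ + 1) and dividing one by the other gives
-- the relation for s; the nonzero f n cancels.
geometric-quotient : ∀ {f g s : ℕ → ℤ} → (∀ n → g n ≡ f n * s n) → Geometric f → Geometric g → Geometric s
geometric-quotient {f} {g} {s} g≡fs (f≢0 , T , n₀ , α , β , α≢0 , f~) (g≢0 , T′ , n₀′ , α′ , β′ , α′≢0 , g~) =
  s≢0 , T ℕ.+ T′ ℕ.* suc T , n₀ ℕ.+ n₀′ , β ^ᶻ suc T′ * α′ ^ᶻ suc T , α ^ᶻ suc T′ * β′ ^ᶻ suc T ,
  *-≢0 (^-≢0 (suc T′) β≢0) (^-≢0 (suc T) α′≢0) , s~
  where
  s≢0 : ∀ n → s n ≢ 0ℤ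
  s≢0 n sn≡0 = g≢0 n (trans (g≡fs n) (trans (cong (f n *_) sn≡0) (ℤ.*-zeroʳ (f n))))
  -- β moves to the left-hand constant of the quotient. If it were 0, then α times a nonzero value
  -- of f would be 0.
  β≢0 : β ≢ 0ℤ
  β≢0 β≡0 = *-≢0 α≢0 (f≢0 (n₀ ℕ.+ suc T)) (0∣⇒≡0 (subst (_∣ α * f (n₀ ℕ.+ suc T))
    (trans (cong (_* f n₀) β≡0) (ℤ.*-zeroˡ (f n₀))) (proj₂ (f~ n₀ ℕ.≤-refl))))
  s~ : ∀ n → n ℕ.≥ n₀ ℕ.+ n₀′ → β ^ᶻ suc T′ * α′ ^ᶻ suc T * s (n ℕ.+ suc T′ ℕ.* suc T) ~ α ^ᶻ suc T′ * β′ ^ᶻ suc T * s n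
  s~ n n≥ = ~-cancelˡ (f n) (f≢0 n) (~-trans
    (subst₂ _~_ (lem₁ α̂′ s⁺ β̂ (f n)) (trans (lem₂ α̂′ s⁺ α̂ f⁺) (cong (λ t → α̂ * (α̂′ * t)) (sym (g≡fs n⁺))))
      (swap (~-*ˡ (α̂′ * s⁺) (geometric-iterate {f} {suc T} {n₀} {α} {β} f~ (suc T′) n (ℕ.≤-trans (ℕ.m≤m+n n₀ n₀′) n≥)))))
    (subst (α̂ * (α̂′ * g n⁺) ~_) (trans (cong (λ t → α̂ * (β̂′ * t)) (g≡fs n)) (lem₃ α̂ β̂′ (f n) (s n)))
      (~-*ˡ α̂ (subst (λ t → α̂′ * g (n ℕ.+ t) ~ β̂′ * g n) (ℕ.*-comm (suc T) (suc T′))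
        (geometric-iterate {g} {suc T′} {n₀′} {α′} {β′} g~ (suc T) n (ℕ.≤-trans (ℕ.m≤n+m n₀′ n₀) n≥))))))
    where
    n⁺ : ℕ
    n⁺ = n ℕ.+ suc T′ ℕ.* suc T
    f⁺ s⁺ α̂ β̂ α̂′ β̂′ : ℤ
    f⁺ = f n⁺
    s⁺ = s n⁺
    α̂  = α ^ᶻ suc T′
    β̂  = β ^ᶻ suc T′
    α̂′ = α′ ^ᶻ suc T
    β̂′ = β′ ^ᶻ suc T
    lem₁ : ∀ a s b f → a * s * (b * f) ≡ f * (b * a * s)
    lem₁ = solve-∀
    lem₂ : ∀ a s b f → a * s * (b * f) ≡ b * (a * (f * s))
    lem₂ = solve-∀
    lem₃ : ∀ a b f s → a * (b * (f * s)) ≡ f * (a * b * s)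
    lem₃ = solve-∀

Periodic : (ℕ → ℤ) → ℕ → ℕ → Set
Periodic q n₀ T = ∀ n → n ℕ.≥ n₀ → q (n ℕ.+ T) ≡ q n

periodic-* : ∀ {q n₀ T} → Periodic q n₀ T → ∀ k → Periodic q n₀ (k ℕ.* T)
periodic-* {q} per zero    n n≥n₀ = cong q (ℕ.+-identityʳ n)
periodic-* {q} {n₀} {T} per (suc k) n n≥n₀ = trans (cong q (sym (ℕ.+-assoc n T (k ℕ.* T))))
  (trans (periodic-* per k (n ℕ.+ T) (ℕ.m≤n⇒m≤n+o T n≥n₀)) (per n n≥n₀))

commonPeriod : ∀ {m} (q : Fin m → ℕ → ℤ) → (∀ i → ∃[ n₀ ] ∃[ T ] Periodic (q i) n₀ (suc T)) →
  ∃[ n₀ ] ∃[ T ] ∀ i → Periodic (q i) n₀ (suc T)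
commonPeriod {zero}  q per = 0 , 0 , λ ()
commonPeriod {suc m} q per =
  let n₁ , T₁ , per₁ = per zero
      n₂ , T₂ , per₂ = commonPeriod (q ∘ suc) (per ∘ suc)
  in n₁ ℕ.+ n₂ , T₁ ℕ.+ T₂ ℕ.* suc T₁ , λ
    { zero    n n≥ → periodic-* {q zero} per₁ (suc T₂) n (ℕ.≤-trans (ℕ.m≤m+n n₁ n₂) n≥)
    ; (suc i) n n≥ → subst (λ T → q (suc i) (n ℕ.+ T) ≡ q (suc i) n) (ℕ.*-comm (suc T₁) (suc T₂))
        (periodic-* {q (suc i)} (per₂ i) (suc T₁) n (ℕ.≤-trans (ℕ.m≤n+m n₂ n₁) n≥))
    }

module Ratio (s : ℕ → ℤ) (s∣s : ∀ n → s n ∣ s (suc n)) where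

  -- Where s n = 0 the divisibility witness carries no information, so the ratio is set to 0.
  ratioOf : ∀ n → Dec (s n ≡ 0ℤ) → ℤ
  ratioOf n (yes _) = 0ℤ
  ratioOf n (no _)  = quotient (s∣s n)

  ratio : ℕ → ℤ
  ratio n = ratioOf n (s n ℤ.≟ 0ℤ)

  ratioOf-zero : ∀ n d → s n ≡ 0ℤ → ratioOf n d ≡ 0ℤ
  ratioOf-zero n (yes _)   _    = refl
  ratioOf-zero n (no s≢0) s≡0 = contradiction s≡0 s≢0

  ratioOf-spec : ∀ n d → s (suc n) ≡ ratioOf n d * s n
  ratioOf-spec n (yes s≡0) = trans (0∣⇒≡0 (subst (_∣ s (suc n)) s≡0 (s∣s n))) (sym (ℤ.*-zeroˡ (s n)))
  ratioOf-spec n (no _)    = _∣_.equality (s∣s n)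

  ratio-spec : ∀ n → s (suc n) ≡ ratio n * s n
  ratio-spec n = ratioOf-spec n (s n ℤ.≟ 0ℤ)

  -- In the nonzero case, nonnegativity turns association into equality. The same constants a and b
  -- then hold at n and at n + 1, so they cancel from the ratio.
  ratio-periodic : (∀ n → 0ℤ ℤ.≤ s n) → EventuallyZero s ⊎ Geometric s → ∃[ n₀ ] ∃[ T ] Periodic ratio n₀ (suc T)
  ratio-periodic 0≤s (inj₁ (n₀ , s≡0)) = n₀ , 0 , λ n n≥n₀ →
    trans (zero-ratio (n ℕ.+ 1) (ℕ.m≤n⇒m≤n+o 1 n≥n₀)) (sym (zero-ratio n n≥n₀))
    where
    zero-ratio : ∀ n → n ℕ.≥ n₀ → ratio n ≡ 0ℤ
    zero-ratio n n≥n₀ = ratioOf-zero n (s n ℤ.≟ 0ℤ) (s≡0 n n≥n₀)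
  ratio-periodic 0≤s (inj₂ (s≢0 , T , n₀ , α , β , α≢0 , s~)) = n₀ , T , λ n n≥n₀ →
    *-cancelˡ-≢0 (a * s (n ℕ.+ suc T)) (*-≢0 a≢0 (s≢0 (n ℕ.+ suc T))) (begin
      a * s (n ℕ.+ suc T) * ratio (n ℕ.+ suc T)     ≡⟨ lem₁ a (s (n ℕ.+ suc T)) (ratio (n ℕ.+ suc T)) ⟩
      a * (ratio (n ℕ.+ suc T) * s (n ℕ.+ suc T))   ≡⟨ cong (a *_) (ratio-spec (n ℕ.+ suc T)) ⟨
      a * s (suc n ℕ.+ suc T)                       ≡⟨ s≡ (suc n) (ℕ.m≤n⇒m≤1+n n≥n₀) ⟩
      b * s (suc n)                                 ≡⟨ cong (b *_) (ratio-spec n) ⟩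
      b * (ratio n * s n)                           ≡⟨ lem₂ b (ratio n) (s n) ⟩
      b * s n * ratio n                             ≡⟨ cong (_* ratio n) (s≡ n n≥n₀) ⟨
      a * s (n ℕ.+ suc T) * ratio n                 ∎)
    where
    open ≡-Reasoning
    a b : ℤ
    a = pos ℤ.∣ α ∣
    b = pos ℤ.∣ β ∣
    a≢0 : a ≢ 0ℤ
    a≢0 a≡0 = α≢0 (ℤ.∣i∣≡0⇒i≡0 (ℤ.+-injective a≡0))
    s≡ : ∀ n → n ℕ.≥ n₀ → a * s (n ℕ.+ suc T) ≡ b * s n
    s≡ n n≥n₀ = ~-nonnegative {α} {β} (0≤s (n ℕ.+ suc T)) (0≤s n) (s~ n n≥n₀)
    lem₁ : ∀ a s r → a * s * r ≡ a * (r * s)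
    lem₁ = solve-∀
    lem₂ : ∀ b r s → b * (r * s) ≡ b * s * r
    lem₂ = solve-∀

-- Some factor is 0, and zeros propagate upwards along the divisibility chain.
∏<-≡0 : ∀ n f → (∀ {k l} → k ℕ.≤ l → f k ∣ f l) → ∏< (suc n) f ≡ 0ℤ → f n ≡ 0ℤ
∏<-≡0 n f mono eq = [ earlier n , (λ fn≡0 → fn≡0) ]′ (ℤ.i*j≡0⇒i≡0∨j≡0 (∏< n f) eq)
  where
  earlier : ∀ n → ∏< n f ≡ 0ℤ → f n ≡ 0ℤ
  earlier (suc n) eq = 0∣⇒≡0 (subst (_∣ f (suc n)) (∏<-≡0 n f mono eq) (mono (ℕ.n≤1+n n)))

-- Each invariant factor is the quotient of two consecutive determinantal divisors. The geometric
-- alternative excludes all zeros, so a vanishing smaller divisor cannot meet a geometric larger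
-- one.
invariantFactor-dichotomy : ∀ {m} (A : Matrix m) (S : ℕ → Matrix m) → (∀ n → IsSmithForm (A ^ n) (S n)) →
  ∀ i → EventuallyZero (λ n → S n i i) ⊎ Geometric (λ n → S n i i)
invariantFactor-dichotomy A S smith i = cases
  (determinantalDivisor-dichotomy A S smith (toℕ i) (ℕ.<⇒≤ (Fin.toℕ<n i)))
  (determinantalDivisor-dichotomy A S smith (suc (toℕ i)) (Fin.toℕ<n i))
  where
  f g : ℕ → ℤ
  f n = ∏< (toℕ i) (entry (S n))
  g n = ∏< (suc (toℕ i)) (entry (S n))
  g≡ : ∀ n → g n ≡ f n * S n i i
  g≡ n = cong (f n *_) (entry-toℕ (S n) i)
  cases : EventuallyZero f ⊎ Geometric f → EventuallyZero g ⊎ Geometric g → EventuallyZero (λ n → S n i i) ⊎ Geometric (λ n → S n i i)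
  cases _ (inj₁ (n₀ , g≡0)) = inj₁ (n₀ , λ n n≥n₀ →
    trans (sym (entry-toℕ (S n) i)) (∏<-≡0 (toℕ i) (entry (S n)) (entry-mono (smith n)) (g≡0 n n≥n₀)))
  cases (inj₁ (n₀ , f≡0)) (inj₂ (g≢0 , _)) = contradiction
    (trans (g≡ n₀) (trans (cong (_* S n₀ i i) (f≡0 n₀ ℕ.≤-refl)) (ℤ.*-zeroˡ (S n₀ i i)))) (g≢0 n₀)
  cases (inj₂ geo-f) (inj₂ geo-g) = inj₂ (geometric-quotient {f} {g} g≡ geo-f geo-g)

theorem1p1 : (m : ℕ) (A : Matrix m) (S : ℕ → Matrix m) →
    (∀ n → IsSmithForm (A ^ n) (S n)) →
    ∃[ D ] (∀ n → Diagonal (D n)) × EventuallyPeriodic _≈_ D × (∀ n → S (suc n) ≈ D n · S n)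
theorem1p1 m A S smith = D , D-diagonal , D-periodic , D-spec
  where
  open IsSmithForm
  module R (i : Fin m) = Ratio (λ n → S n i i) (λ n → invariantFactor-∣ A (smith n) (smith (suc n)) i)
  D : ℕ → Matrix m
  D n i j = R.ratio i n * identity i j
  D-diagonal : ∀ n → Diagonal (D n)
  D-diagonal n i j i≢j = trans (cong (R.ratio i n *_) (identity-≢ i≢j)) (ℤ.*-zeroʳ (R.ratio i n))
  D-periodic : EventuallyPeriodic _≈_ D
  D-periodic = let n₀ , T , periodic = commonPeriod R.ratio (λ i →
                     R.ratio-periodic i (λ n → nonnegative (smith n) i) (invariantFactor-dichotomy A S smith i))
               in n₀ , suc T , s≤s z≤n , λ n n≥n₀ i j → cong (_* identity i j) (periodic i n n≥n₀)
  D-spec : ∀ n → S (suc n) ≈ D n · S n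
  D-spec n i j = begin
    S (suc n) i j                                        ≡⟨ entries (i Fin.≟ j) ⟩
    R.ratio i n * S n i j                                ≡⟨ cong (R.ratio i n *_) (identity-∙ i λ k → S n k j) ⟨
    R.ratio i n * identity i ∙ (λ k → S n k j)           ≡⟨ *-distribˡ-sum (R.ratio i n) (λ k → identity i k * S n k j) ⟩
    sum (λ k → R.ratio i n * (identity i k * S n k j))   ≡⟨ sum-cong-≗ (λ k → sym (ℤ.*-assoc (R.ratio i n) (identity i k) (S n k j))) ⟩
    (D n · S n) i j                                      ∎
    where
    open ≡-Reasoning
    entries : Dec (i ≡ j) → S (suc n) i j ≡ R.ratio i n * S n i j
    entries (yes refl) = R.ratio-spec i n
    entries (no i≢j)   = trans (diagonal (smith (suc n)) i j i≢j)
      (sym (trans (cong (R.ratio i n *_) (diagonal (smith n) i j i≢j)) (ℤ.*-zeroʳ (R.ratio i n))))
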